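{- Fix a positive integer $d$. Suppose $G$ is a purely nonabelian finite group, and $A\subseteq G$ has VC-dimension at most $d$. Then, for any $\epsilon>0$, there is a normal subgroup $H$ of $G$, of index $O_{d,\epsilon}(1)$, which satisfies the following properties. \begin{enumerate} \item[(i)] (structure) There is a set $D\subseteq G$, which is a union of cosets of $H$, such that $|A\,\triangle\, D|\leq \epsilon|G|$. \item[(ii)] (regularity) There is a set $Z\subseteq G$, with $|Z|<\frac{1}{2}\epsilon^{1/2}|G|$, such that for any $x\in G\setminus Z$, either $|xH\cap A|\leq\epsilon^{1/4}|H|$ or $|xH\setminus A|\leq\epsilon^{1/4}|H|$. \end{enumerate}
   Context: A nontrivial group $G$ is purely nonabelian if $[H,H]=H$ for every normal subgroup $H$ of $G$ (no normal subgroup has a nontrivial abelian quotient). The VC-dimension of $A\subseteq G$ is the supremum of integers $d$ such that for some $d$-element $X\subseteq G$, every subset of $X$ equals $X\cap gA$ for some $g\in G$. $\triangle$ denotes symmetric difference. $O_{d,\epsilon}(1)$ denotes a quantity bounded by a constant depending only on $d,\epsilon$. -}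

module Defs where

open import Data.Nat as ℕ using (ℕ; suc; _≤_)
open import Data.Integer using (+_)
open import Data.Rational as ℚ using (ℚ)
open import Data.Fin using (Fin)
open import Data.Fin.Subset using (Subset; _∈_; _∉_; _⊆_; _∩_; _∪_; _─_; ∣_∣)
open import Data.Vec using (tabulate; lookup)
open import Data.Bool using (Bool)
open import Data.List using (List; []; _∷_)
open import Data.List.Relation.Unary.All using (All)
open import Data.Product using (_×_; _,_; ∃; ∃-syntax)
open import Relation.Binary.PropositionalEquality using (_≡_)
open import Algebra.Structures using (IsGroup)

record FinGroup : Set where
  field
    n       : ℕ
    _∙_     : Fin n → Fin n → Fin n
    e       : Fin n
    _⁻¹     : Fin n → Fin n
    isGroup : IsGroup {A = Fin n} _≡_ _∙_ e _⁻¹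

module _ (G : FinGroup) where
  open FinGroup G

  order : ℕ
  order = n

  coset : Fin n → Subset n → Subset n
  coset x S = tabulate λ y → lookup S ((x ⁻¹) ∙ y)

  IsNormalSubgroup : Subset n → Set
  IsNormalSubgroup H =
    (e ∈ H)
    × (∀ a b → a ∈ H → b ∈ H → (a ∙ b) ∈ H)
    × (∀ a → a ∈ H → (a ⁻¹) ∈ H)
    × (∀ g a → a ∈ H → ((g ∙ a) ∙ (g ⁻¹)) ∈ H)

  commutator : Fin n → Fin n → Fin n
  commutator a b = ((a ⁻¹) ∙ (b ⁻¹)) ∙ (a ∙ b)

  prodComm : List (Fin n × Fin n) → Fin n
  prodComm []             = e
  prodComm ((a , b) ∷ ps) = commutator a b ∙ prodComm ps

  -- x ∈ [H,H]: x lies in the subgroup generated by the commutators [a,b], a,b ∈ H,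
  -- i.e. x is a finite product of such commutators (closed under inverses
  -- since [a,b]⁻¹ = [b,a]).
  InCommutatorSubgroup : Subset n → Fin n → Set
  InCommutatorSubgroup H x =
    ∃[ ps ] (All (λ p → (Data.Product.proj₁ p ∈ H) × (Data.Product.proj₂ p ∈ H)) ps
             × prodComm ps ≡ x)

  IsPerfect : Subset n → Set
  IsPerfect H = ∀ x → (x ∈ H → InCommutatorSubgroup H x) × (InCommutatorSubgroup H x → x ∈ H)

  PurelyNonabelian : Set
  PurelyNonabelian = (2 ≤ n) × (∀ H → IsNormalSubgroup H → IsPerfect H)

  Shattered : Subset n → Subset n → Set
  Shattered A X = ∀ Y → Y ⊆ X → ∃[ g ] (X ∩ coset g A ≡ Y)

  VCdim≤ : Subset n → ℕ → Set
  VCdim≤ A d = ∀ X → Shattered A X → ∣ X ∣ ≤ d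

  UnionOfCosets : Subset n → Subset n → Set
  UnionOfCosets H D = ∀ x → x ∈ D → coset x H ⊆ D

_△_ : ∀ {n} → Subset n → Subset n → Subset n
A △ B = (A ─ B) ∪ (B ─ A)

ℕ→ℚ : ℕ → ℚ
ℕ→ℚ k = (+ k) ℚ./ 1

-- Let M be the 0/1 matrix whose rows are the translates gA, F = M Mᵀ their Gram matrix, and D h the difference
-- operator "left translation by h minus identity".  F is left invariant, so it commutes with translations and
-- ‖D [a,b] Q²‖ ≤ 2 ‖D a Q‖ ‖D b Q‖ for every power Q of F (Hilbert–Schmidt norms).  Bounded VC-dimension gives, by
-- Haussler-type packing, boundedly many classes of translates, hence the elements h with |hgA △ gA| small for all g
-- generate a normal subgroup H of bounded index.  As H is perfect, it is generated by commutators of its generators,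
-- so the commutator estimate can be iterated: ‖D h F^(2^k)‖² ≤ C r^(2^k) for all k and all h ∈ H, with r small and C
-- independent of k.  Since ‖D h Fʲ‖ is log-convex in j, this already forces ‖D h F‖² ≤ √r ‖D h M‖²: on the spectral
-- side, h moves only eigenvectors with small eigenvalues.  The packing bound gives the reverse inequality
-- up to an error, so ‖D h M‖² = ∑_g |hgA △ gA| is small for all h ∈ H.  Averaging over H shows that A is nearly a
-- union of cosets, and Markov's inequality gives the regularity statement.
--
-- No real numbers are needed: δ is replaced by 1/c with c its denominator, and all estimates are in ℕ and ℤ.
module Submission where

open import Defs
open import Data.Nat using (ℕ; _≤_; _*_)
open import Data.Rational using (ℚ; 0ℚ; ½) renaming (_<_ to _<ℚ_; _≤_ to _≤ℚ_; _*_ to _*ℚ_)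
open import Data.Fin.Subset using (Subset; _∈_; _∉_; _∩_; _─_; ∣_∣)
open import Data.Product using (_×_; ∃-syntax)
open import Data.Sum using (_⊎_)

open import Algebra.Bundles using (Group)
import Algebra.Properties.Group as GroupProperties
import Algebra.Properties.Semiring.Sum as SemiringSum
open import Data.Bool using (Bool; true; false; _∧_; _∨_)
import Data.Bool.Properties as Bool
open import Data.Empty using (⊥; ⊥-elim)
open import Data.Fin using (Fin; zero; suc; funToFin; finToFun)
open import Data.Fin.Permutation using (permutation)
import Data.Fin.Properties as Fin
open import Data.Fin.Subset using (_⊆_; _∪_; ⁅_⁆)
import Data.Fin.Subset as Subset
import Data.Fin.Subset.Properties as Subset
open import Data.Integer using (ℤ; -[1+_]) renaming (+_ to pos)
import Data.Integer as ℤ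
import Data.Integer.Properties as ℤ
open import Data.Integer.Tactic.RingSolver using () renaming (solve-∀ to ℤ-solve-∀)
open import Data.List using (List; []; _∷_; length; map; _++_; filter)
import Data.List as List
open import Data.List.Properties using (length-++; length-map)
open import Data.List.Relation.Unary.All using (All; []; _∷_)
import Data.List.Relation.Unary.All as All
import Data.List.Relation.Unary.All.Properties as All
open import Data.List.Relation.Unary.AllPairs using (AllPairs; []; _∷_)
import Data.List.Relation.Unary.AllPairs as AllPairs
import Data.List.Relation.Unary.Any as Any
import Data.List.Relation.Unary.Any.Properties as Any
open import Data.Nat using (zero; suc; _+_; _^_; _<_; z≤n; s≤s; _≤?_; _<?_)
import Data.Nat as ℕ
open import Data.Nat.DivMod using (_/_; m/n*n≤m; m*n/n≡m; /-monoˡ-≤)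
open import Data.Nat.Properties hiding (_≟_)
open import Data.Nat.Tactic.RingSolver using (solve-∀)
open import Data.Product using (_,_; proj₁; proj₂; ∃)
import Data.Rational as ℚ
import Data.Rational.Properties as ℚ
open import Data.Rational.Unnormalised using (ℚᵘ; mkℚᵘ)
import Data.Rational.Unnormalised as ℚᵘ
import Data.Rational.Unnormalised.Properties as ℚᵘ
open import Data.Sum using (inj₁; inj₂; [_,_]′)
open import Data.Vec using (Vec; []; _∷_; lookup; tabulate)
import Data.Vec.Properties as Vec
open import Function using (_∘_; id; case_of_; it; mk⇔)
open import Relation.Binary.PropositionalEquality
import Relation.Binary.PropositionalEquality as ≡
open import Relation.Nullary using (yes; no; does; contradiction)
open import Relation.Nullary.Decidable using (_×-dec_; _→-dec_; dec-true; dec-false)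
open import Relation.Unary using (Decidable)

open SemiringSum +-*-semiring
  using (sum; sum-cong-≗; ∑-distrib-+; ∑-comm; ∑-permute; *-distribˡ-sum; *-distribʳ-sum)
module ℤΣ = SemiringSum ℤ.+-*-semiring

-- The obstacle is word length. Adding up the displacements of the small elements whose product is
-- `h ∈ H` gives nothing: the density of the small elements bounds the number of factors only in
-- terms of the index, hence of the fine covering number `l`, and `l` itself exceeds `p * p`, while
-- one factor gains only `1 / (p * p)`. The powers `Q k` make this loss harmless. Words of length
-- `N`, the order of the group, suffice at every power, so the cost is the same factor `4 ^ N` for
-- all `k`, against bounds of the form `r ^ (2 ^ k)`; under roots of order `2 ^ k` only `r`
-- survives. The reverse inequality rests on density: for each `g` at least `N / k` of the `x` have
-- `gxA` close to `gA`. If `hgA` is far from `gA`, it is far from all of these, and since `F` is the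
-- distance matrix up to a constant and a factor, `D h F` is large at all these positions. Hence
-- there are two covering scales: a coarse one, fixing `k`, and a fine one, chosen afterwards so
-- that the spectral gain beats `k`.

private variable
  k m n : ℕ

-- Finite sums and Cauchy-Schwarz in integer form

sum-mono : {f g : Fin n → ℕ} → (∀ i → f i ≤ g i) → sum f ≤ sum g
sum-mono {zero}  h = z≤n
sum-mono {suc n} h = +-mono-≤ (h zero) (sum-mono (h ∘ suc))

sum-const : ∀ n c → sum {n} (λ _ → c) ≡ n * c
sum-const zero    c = refl
sum-const (suc n) c = cong (c +_) (sum-const n c)

term≤sum : (f : Fin n → ℕ) (i : Fin n) → f i ≤ sum f
term≤sum f zero    = m≤m+n _ _
term≤sum f (suc i) = ≤-trans (term≤sum (f ∘ suc) i) (m≤n+m _ _)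

sum-reindex : (f : Fin n → ℕ) (φ ψ : Fin n → Fin n) →
              (∀ i → φ (ψ i) ≡ i) → (∀ i → ψ (φ i) ≡ i) → sum f ≡ sum (f ∘ φ)
sum-reindex f φ ψ φψ ψφ = ∑-permute f (permutation φ ψ φψ ψφ)

sumℤ-reindex : (f : Fin n → ℤ) (φ ψ : Fin n → Fin n) →
               (∀ i → φ (ψ i) ≡ i) → (∀ i → ψ (φ i) ≡ i) → ℤΣ.sum f ≡ ℤΣ.sum (f ∘ φ)
sumℤ-reindex f φ ψ φψ ψφ = ℤΣ.∑-permute f (permutation φ ψ φψ ψφ)

sum-pos : (f : Fin n → ℕ) → pos (sum f) ≡ ℤΣ.sum (λ i → pos (f i))
sum-pos {zero}  f = refl
sum-pos {suc n} f = cong (λ z → pos (f zero) ℤ.+ z) (sum-pos (f ∘ suc))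

sumℤ-neg : (f : Fin n → ℤ) → ℤΣ.sum (λ i → ℤ.- f i) ≡ ℤ.- ℤΣ.sum f
sumℤ-neg {zero}  f = refl
sumℤ-neg {suc n} f = trans (cong (λ z → ℤ.- f zero ℤ.+ z) (sumℤ-neg (f ∘ suc)))
                           (sym (ℤ.neg-distrib-+ (f zero) _))

sumℤ-minus : (f g : Fin n → ℤ) →
             ℤΣ.sum (λ i → f i ℤ.- g i) ≡ ℤΣ.sum f ℤ.- ℤΣ.sum g
sumℤ-minus f g = trans (ℤΣ.∑-distrib-+ f (λ i → ℤ.- g i))
                       (cong (λ z → ℤΣ.sum f ℤ.+ z) (sumℤ-neg g))

sq : ℤ → ℕ
sq z = ℤ.∣ z ∣ * ℤ.∣ z ∣

pos-sq : ∀ z → pos (sq z) ≡ z ℤ.* z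
pos-sq z@(pos _)    = ℤ.pos-* ℤ.∣ z ∣ ℤ.∣ z ∣
pos-sq z@(-[1+ _ ]) = refl

sq-* : ∀ x y → sq (x ℤ.* y) ≡ sq x * sq y
sq-* x y rewrite ℤ.∣i*j∣≡∣i∣*∣j∣ x y = [m*n]*[o*p]≡[m*o]*[n*p] ℤ.∣ x ∣ ℤ.∣ y ∣ ℤ.∣ x ∣ ℤ.∣ y ∣

sq-neg : ∀ x → sq (ℤ.- x) ≡ sq x
sq-neg x = cong (λ t → t * t) (ℤ.∣-i∣≡∣i∣ x)

square-cancel-≤ : ∀ {x y} → x * x ≤ y * y → x ≤ y
square-cancel-≤ {x} {y} h with x ≤? y
... | yes x≤y = x≤y
... | no  x≰y = contradiction h (<⇒≱ (*-mono-< (≰⇒> x≰y) (≰⇒> x≰y)))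

am-gm : ∀ u v → 4 * (u * v) ≤ (u + v) * (u + v)
am-gm u v = [ ordered u v , (λ v≤u → subst₂ _≤_ (cong (4 *_) (*-comm v u))
                                       (cong (λ t → t * t) (+-comm v u)) (ordered v u v≤u)) ]′ (≤-total u v)
  where
  identity : ∀ u w → (u + (u + w)) * (u + (u + w)) ≡ 4 * (u * (u + w)) + w * w
  identity = solve-∀
  ordered : ∀ u v → u ≤ v → 4 * (u * v) ≤ (u + v) * (u + v)
  ordered u v u≤v with w , refl ← m≤n⇒∃[o]m+o≡n u≤v =
    subst (4 * (u * (u + w)) ≤_) (sym (identity u w)) (m≤m+n _ _)

-- The cross term `2 * (x * y)` is at most `a * d + c * b`: its square is at most
-- `4 * ((a * d) * (c * b))`, and AM-GM applies.
square-+-≤ : ∀ x y a b c d → x * x ≤ a * b → y * y ≤ c * d →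
             (x + y) * (x + y) ≤ (a + c) * (b + d)
square-+-≤ x y a b c d p q = begin
  (x + y) * (x + y)                       ≡⟨ expand x y ⟩
  x * x + y * y + 2 * (x * y)             ≤⟨ +-mono-≤ (+-mono-≤ p q) cross ⟩
  a * b + c * d + (a * d + c * b)         ≡⟨ collect a b c d ⟩
  (a + c) * (b + d)                       ∎
  where
  open ≤-Reasoning
  expand : ∀ x y → (x + y) * (x + y) ≡ x * x + y * y + 2 * (x * y)
  expand = solve-∀
  collect : ∀ a b c d → a * b + c * d + (a * d + c * b) ≡ (a + c) * (b + d)
  collect = solve-∀
  rearr₁ : ∀ x y → 2 * (x * y) * (2 * (x * y)) ≡ 4 * ((x * x) * (y * y))
  rearr₁ = solve-∀
  rearr₂ : ∀ a b c d → (a * b) * (c * d) ≡ (a * d) * (c * b)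
  rearr₂ = solve-∀
  cross : 2 * (x * y) ≤ a * d + c * b
  cross = square-cancel-≤ (begin
    2 * (x * y) * (2 * (x * y))           ≡⟨ rearr₁ x y ⟩
    4 * ((x * x) * (y * y))               ≤⟨ *-monoʳ-≤ 4 (*-mono-≤ p q) ⟩
    4 * ((a * b) * (c * d))               ≡⟨ cong (4 *_) (rearr₂ a b c d) ⟩
    4 * ((a * d) * (c * b))               ≤⟨ am-gm (a * d) (c * b) ⟩
    (a * d + c * b) * (a * d + c * b)     ∎)

-- Majorants `α i * β i` take the place of squares, so that the conclusion for each row of a matrix
-- is the hypothesis for the sum over the rows.
cauchy-schwarz : (p : Fin n → ℤ) (α β : Fin n → ℕ) → (∀ i → sq (p i) ≤ α i * β i) →
                 sq (ℤΣ.sum p) ≤ sum α * sum β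
cauchy-schwarz {zero}  p α β h = z≤n
cauchy-schwarz {suc n} p α β h = begin
  sq (p zero ℤ.+ ℤΣ.sum (p ∘ suc))                 ≤⟨ *-mono-≤ tri tri ⟩
  (ℤ.∣ p zero ∣ + ℤ.∣ ℤΣ.sum (p ∘ suc) ∣) * (ℤ.∣ p zero ∣ + ℤ.∣ ℤΣ.sum (p ∘ suc) ∣)
    ≤⟨ square-+-≤ ℤ.∣ p zero ∣ ℤ.∣ ℤΣ.sum (p ∘ suc) ∣ (α zero) (β zero) (sum (α ∘ suc)) (sum (β ∘ suc)) (h zero) (cauchy-schwarz (p ∘ suc) (α ∘ suc) (β ∘ suc) (h ∘ suc)) ⟩
  sum α * sum β                                     ∎
  where
  open ≤-Reasoning
  tri = ℤ.∣i+j∣≤∣i∣+∣j∣ (p zero) (ℤΣ.sum (p ∘ suc))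

sq-+-≤ : ∀ x y → sq (x ℤ.+ y) ≤ 2 * sq x + 2 * sq y
sq-+-≤ x y = begin
  sq (x ℤ.+ y)                               ≤⟨ *-mono-≤ (ℤ.∣i+j∣≤∣i∣+∣j∣ x y) (ℤ.∣i+j∣≤∣i∣+∣j∣ x y) ⟩
  (ℤ.∣ x ∣ + ℤ.∣ y ∣) * (ℤ.∣ x ∣ + ℤ.∣ y ∣)  ≤⟨ square-+-≤ ℤ.∣ x ∣ ℤ.∣ y ∣ (sq x) 1 (sq y) 1
        (≤-reflexive (sym (*-identityʳ (sq x))))
        (≤-reflexive (sym (*-identityʳ (sq y)))) ⟩
  (sq x + sq y) * 2                          ≡⟨ *-comm (sq x + sq y) 2 ⟩
  2 * (sq x + sq y)                          ≡⟨ *-distribˡ-+ 2 (sq x) (sq y) ⟩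
  2 * sq x + 2 * sq y                        ∎
  where open ≤-Reasoning

-- Exponential growth against linear and polynomial growth

^-distrib-* : ∀ a b k → (a * b) ^ k ≡ a ^ k * b ^ k
^-distrib-* a b zero    = refl
^-distrib-* a b (suc k) = trans (cong (a * b *_) (^-distrib-* a b k))
                                ([m*n]*[o*p]≡[m*o]*[n*p] a b (a ^ k) (b ^ k))

bernoulli : ∀ q k → (q + k) * q ^ k ≤ suc q ^ k * q
bernoulli q zero    = ≤-reflexive (trans (*-identityʳ (q + 0)) (trans (+-identityʳ q) (sym (*-identityˡ q))))
bernoulli q (suc k) = begin
  (q + suc k) * (q * q ^ k)                    ≤⟨ m≤m+n _ (k * q ^ k) ⟩
  (q + suc k) * (q * q ^ k) + k * q ^ k        ≡⟨ identity q k (q ^ k) ⟩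
  suc q * ((q + k) * q ^ k)                    ≤⟨ *-monoʳ-≤ (suc q) (bernoulli q k) ⟩
  suc q * (suc q ^ k * q)                      ≡⟨ sym (*-assoc (suc q) (suc q ^ k) q) ⟩
  suc q ^ suc k * q                            ∎
  where
  open ≤-Reasoning
  identity : ∀ q k x → (q + suc k) * (q * x) + k * x ≡ suc q * ((q + k) * x)
  identity = solve-∀

n<2^n : ∀ n → n < 2 ^ n
n<2^n zero    = s≤s z≤n
n<2^n (suc n) = begin
  suc (suc n)          ≤⟨ +-mono-≤ (m^n>0 2 n) (n<2^n n) ⟩
  2 ^ n + 2 ^ n        ≡⟨ cong (λ t → 2 ^ n + t) (sym (+-identityʳ (2 ^ n))) ⟩
  2 ^ suc n            ∎
  where open ≤-Reasoning

linear<exponential : ∀ c → ∃ λ i → c * i + 2 < 2 ^ i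
-- With `u = c + 2` the linear side stays below `suc u * (2 * u)`, and each of these two factors is
-- at most `2 ^ u`.
linear<exponential c = u + u , (begin-strict
  c * (u + u) + 2                    <⟨ m<m+n _ {10 + 6 * c} (s≤s z≤n) ⟩
  c * (u + u) + 2 + (10 + 6 * c)     ≡⟨ identity c ⟩
  suc u * (2 * u)                    ≤⟨ *-mono-≤ (n<2^n u) (*-monoʳ-≤ 2 (n<2^n (suc c))) ⟩
  2 ^ u * 2 ^ u                      ≡⟨ sym (^-distribˡ-+-* 2 u u) ⟩
  2 ^ (u + u)                        ∎)
  where
  open ≤-Reasoning
  u = suc (suc c)
  identity : ∀ c → c * (suc (suc c) + suc (suc c)) + 2 + (10 + 6 * c)
             ≡ suc (suc (suc c)) * (2 * suc (suc c))
  identity = solve-∀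

module _ (d p i : ℕ) where
  private
    q = suc p
    e = suc d + suc d
    M = q * (i * e)

  -- Bernoulli gives `2 * q ^ q ≤ suc q ^ q`. `M` is a multiple of `q` so that this can be raised to
  -- the power `i * e`, and `e` is twice `suc d` because the polynomial occurs squared.
  power<exponential : q * e * i + 2 < 2 ^ i → suc (suc M ^ suc d) * suc (suc M ^ suc d) * q ^ M < suc q ^ M
  power<exponential bound = begin-strict
    suc (suc M ^ suc d) * suc (suc M ^ suc d) * q ^ M    ≤⟨ *-monoˡ-≤ (q ^ M) (*-mono-≤ step step) ⟩
    (suc (suc M) ^ suc d * suc (suc M) ^ suc d) * q ^ M  ≡⟨ cong (_* q ^ M) (sym (^-distribˡ-+-* (suc (suc M)) (suc d) (suc d))) ⟩
    suc (suc M) ^ e * q ^ M                              <⟨ *-monoˡ-< (q ^ M) {{m^n≢0 q M}} (^-monoˡ-< e m+2<2^i) ⟩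
    (2 ^ i) ^ e * q ^ M                                  ≡⟨ cong₂ _*_ (^-*-assoc 2 i e) (sym (^-*-assoc q q (i * e))) ⟩
    2 ^ (i * e) * (q ^ q) ^ (i * e)                      ≡⟨ sym (^-distrib-* 2 (q ^ q) (i * e)) ⟩
    (2 * q ^ q) ^ (i * e)                                ≤⟨ ^-monoˡ-≤ (i * e) doubling ⟩
    (suc q ^ q) ^ (i * e)                                ≡⟨ ^-*-assoc (suc q) q (i * e) ⟩
    suc q ^ M                                            ∎
    where
    open ≤-Reasoning
    step : suc (suc M ^ suc d) ≤ suc (suc M) ^ suc d
    step = ^-monoˡ-< (suc d) (n<1+n (suc M))
    identity : ∀ q i e → suc (suc (q * (i * e))) ≡ q * e * i + 2
    identity = solve-∀
    m+2<2^i : suc (suc M) < 2 ^ i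
    m+2<2^i = subst (_< 2 ^ i) (sym (identity q i e)) bound
    doubling : 2 * q ^ q ≤ suc q ^ q
    doubling = *-cancelʳ-≤ (2 * q ^ q) (suc q ^ q) q
      (≤-trans (≤-reflexive (rearrange q (q ^ q))) (bernoulli q q))
      where
      rearrange : ∀ q x → 2 * x * q ≡ (q + q) * x
      rearrange = solve-∀

abstract
  -- Prepares the packing bound: `m` is the number of coordinates chosen there, and `k` a number of
  -- sets too large for Sauer-Shelah on `m` coordinates, yet small enough that `m` greedy choices
  -- separate all pairs of them.
  polynomial<exponential : ∀ d p → ∃ λ m → ∃ λ k → suc m ^ suc d < k × k * k * suc p ^ m < suc (suc p) ^ m
  polynomial<exponential d p = let i , bound = linear<exponential (suc p * (suc d + suc d)) in
    _ , _ , ≤-refl , power<exponential d p i bound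

-- Otherwise (1 + 1/Y)^(2^k) would stay bounded by C.
^2^k-cancel-≤ : ∀ X Y C → (∀ k → X ^ (2 ^ k) ≤ C * Y ^ (2 ^ k)) → X ≤ Y
^2^k-cancel-≤ X Y C h with X ≤? Y
... | yes X≤Y = X≤Y
... | no  X≰Y = ⊥-elim (absurd Y (≰⇒> X≰Y) h)
  where
  open ≤-Reasoning
  absurd : ∀ Y → Y < X → (∀ k → X ^ (2 ^ k) ≤ C * Y ^ (2 ^ k)) → ⊥
  absurd zero      Y<X h = <-irrefl refl (begin-strict
    0                     <⟨ Y<X ⟩
    X                     ≡⟨ sym (*-identityʳ X) ⟩
    X ^ (2 ^ 0)           ≤⟨ h 0 ⟩
    C * 0                 ≡⟨ *-zeroʳ C ⟩
    0                     ∎)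
  absurd Y@(suc _) Y<X h = <-irrefl refl (begin-strict
    C * Y                 <⟨ n<2^n (C * Y) ⟩
    M                     ≤⟨ m≤n+m M Y ⟩
    Y + M                 ≤⟨ *-cancelʳ-≤ (Y + M) (C * Y) (Y ^ M) {{m^n≢0 Y M}} chain ⟩
    C * Y                 ∎)
    where
    -- The index `C * Y` already contradicts: `chain` leaves `Y + M ≤ C * Y`, while `C * Y < M`.
    M = 2 ^ (C * Y)
    rearrange : ∀ C x Y → C * x * Y ≡ C * Y * x
    rearrange = solve-∀
    chain : (Y + M) * Y ^ M ≤ C * Y * Y ^ M
    chain = begin
      (Y + M) * Y ^ M     ≤⟨ bernoulli Y M ⟩
      suc Y ^ M * Y       ≤⟨ *-monoˡ-≤ Y (^-monoˡ-≤ M Y<X) ⟩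
      X ^ M * Y           ≤⟨ *-monoˡ-≤ Y (h (C * Y)) ⟩
      C * Y ^ M * Y       ≡⟨ rearrange C (Y ^ M) Y ⟩
      C * Y * Y ^ M       ∎

-- The Sauer–Shelah lemma and packing


bit : Bool → ℕ
bit true  = 1
bit false = 0

-- Families of sets are Boolean predicates on vectors, and counting splits along the first
-- coordinate, which is the induction behind Sauer-Shelah.
# : (Vec Bool n → Bool) → ℕ
# {zero}  F = bit (F [])
# {suc n} F = # (F ∘ (true ∷_)) + # (F ∘ (false ∷_))

#-mono : {F F′ : Vec Bool n → Bool} → (∀ v → F v ≡ true → F′ v ≡ true) → # F ≤ # F′
#-mono {zero}  {F} {F′} h with F [] | F′ [] | h []
... | false | _     | _ = z≤n
... | true  | true  | _ = ≤-refl
... | true  | false | e = contradiction (e refl) λ ()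
#-mono {suc n} h = +-mono-≤ (#-mono (h ∘ (true ∷_))) (#-mono (h ∘ (false ∷_)))

#-∨-∧ : (F F′ : Vec Bool n → Bool) → # F + # F′ ≡ # (λ v → F v ∧ F′ v) + # (λ v → F v ∨ F′ v)
#-∨-∧ {zero} F F′ with F [] | F′ []
... | true  | true  = refl
... | true  | false = refl
... | false | true  = refl
... | false | false = refl
#-∨-∧ {suc n} F F′ = begin
  (a + b) + (c + d)                   ≡⟨ swap a b c d ⟩
  (a + c) + (b + d)                   ≡⟨ cong₂ _+_ (#-∨-∧ (F ∘ (true ∷_)) (F′ ∘ (true ∷_))) (#-∨-∧ (F ∘ (false ∷_)) (F′ ∘ (false ∷_))) ⟩
  (a∧c + a∨c) + (b∧d + b∨d)           ≡⟨ swap a∧c a∨c b∧d b∨d ⟩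
  (a∧c + b∧d) + (a∨c + b∨d)           ∎
  where
  open ≡-Reasoning
  a   = # (F ∘ (true ∷_))
  b   = # (F ∘ (false ∷_))
  c   = # (F′ ∘ (true ∷_))
  d   = # (F′ ∘ (false ∷_))
  a∧c = # (λ v → F (true ∷ v) ∧ F′ (true ∷ v))
  a∨c = # (λ v → F (true ∷ v) ∨ F′ (true ∷ v))
  b∧d = # (λ v → F (false ∷ v) ∧ F′ (false ∷ v))
  b∨d = # (λ v → F (false ∷ v) ∨ F′ (false ∷ v))
  swap : ∀ a b c d → (a + b) + (c + d) ≡ (a + c) + (b + d)
  swap = solve-∀

except : Vec Bool n → (Vec Bool n → Bool) → Vec Bool n → Bool
except []          F w           = false
except (true  ∷ v) F (true  ∷ w) = except v (F ∘ (true ∷_)) w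
except (true  ∷ v) F (false ∷ w) = F (false ∷ w)
except (false ∷ v) F (true  ∷ w) = F (true ∷ w)
except (false ∷ v) F (false ∷ w) = except v (F ∘ (false ∷_)) w

#-except : (v : Vec Bool n) (F : Vec Bool n → Bool) → F v ≡ true → # F ≡ suc (# (except v F))
#-except []          F Fv rewrite Fv = refl
#-except (true  ∷ v) F Fv = cong (_+ # (F ∘ (false ∷_))) (#-except v (F ∘ (true ∷_)) Fv)
#-except (false ∷ v) F Fv = trans (cong (λ t → # (F ∘ (true ∷_)) + t) (#-except v (F ∘ (false ∷_)) Fv)) (+-suc _ _)

except-true : (v w : Vec Bool n) (F : Vec Bool n → Bool) → v ≢ w → F w ≡ true → except v F w ≡ true
except-true []          []          F v≢w Fw = contradiction refl v≢w
except-true (true  ∷ v) (true  ∷ w) F v≢w Fw = except-true v w _ (v≢w ∘ cong (true ∷_)) Fw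
except-true (true  ∷ v) (false ∷ w) F v≢w Fw = Fw
except-true (false ∷ v) (true  ∷ w) F v≢w Fw = Fw
except-true (false ∷ v) (false ∷ w) F v≢w Fw = except-true v w _ (v≢w ∘ cong (false ∷_)) Fw

-- Removing the image of the head from `F` lowers the count by exactly one and keeps the other
-- images, which all differ from it.
distinct⇒length≤# : {I : Set} (f : I → Vec Bool n) (F : Vec Bool n → Bool) (xs : List I) →
                    AllPairs (λ x y → f x ≢ f y) xs → All (λ x → F (f x) ≡ true) xs → length xs ≤ # F
distinct⇒length≤# f F []       _          _          = z≤n
distinct⇒length≤# f F (x ∷ xs) (x≢ ∷ ap) (Fx ∷ Fxs) =
  subst (suc (length xs) ≤_) (sym (#-except (f x) F Fx))
    (s≤s (distinct⇒length≤# f (except (f x) F) xs ap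
      (All.zipWith (λ {y} (ne , Fy) → except-true (f x) (f y) F ne Fy) (x≢ , Fxs))))

-- Implies shattering in the usual sense (shattered-trace); the recursion makes the count #-shattered exact.
shattered : (Vec Bool n → Bool) → Vec Bool n → Bool
shattered F []          = F []
shattered F (true  ∷ X) = shattered (λ v → F (true ∷ v) ∧ F (false ∷ v)) X
shattered F (false ∷ X) = shattered (λ v → F (true ∷ v) ∨ F (false ∷ v)) X

#-shattered : (F : Vec Bool n → Bool) → # F ≡ # (shattered F)
#-shattered {zero}  F = refl
#-shattered {suc n} F = trans (#-∨-∧ (F ∘ (true ∷_)) (F ∘ (false ∷_)))
                              (cong₂ _+_ (#-shattered (λ v → F (true ∷ v) ∧ F (false ∷ v)))
                                         (#-shattered (λ v → F (true ∷ v) ∨ F (false ∷ v))))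

shattered-trace : (F : Vec Bool n → Bool) (X : Subset n) → shattered F X ≡ true →
                  ∀ Y → Y ⊆ X → ∃ λ v → F v ≡ true × X ∩ v ≡ Y
shattered-trace F []          h []          _   = [] , h , refl
shattered-trace F (true ∷ X)  h (b ∷ Y)     Y⊆X
  with v , Fv , eq ← shattered-trace _ X h Y (Subset.drop-∷-⊆ Y⊆X)
  with F (true ∷ v) in e₁ | F (false ∷ v) in e₂ | b
... | true | true | true  = true ∷ v , e₁ , cong (true ∷_) eq
... | true | true | false = false ∷ v , e₂ , cong (false ∷_) eq
shattered-trace F (false ∷ X) h (true ∷ Y)  Y⊆X = case Y⊆X Data.Vec.here of λ ()
shattered-trace F (false ∷ X) h (false ∷ Y) Y⊆X
  with v , Fv , eq ← shattered-trace _ X h Y (Subset.drop-∷-⊆ Y⊆X)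
  with F (true ∷ v) in e₁ | F (false ∷ v) in e₂
... | true  | _    = true ∷ v , e₁ , cong (false ∷_) eq
... | false | true = false ∷ v , e₂ , cong (false ∷_) eq

smallSubset : Subset n → ℕ → Subset n → Bool
smallSubset []          d       []          = true
smallSubset (u ∷ U)     d       (false ∷ X) = smallSubset U d X
smallSubset (true ∷ U)  (suc d) (true ∷ X)  = smallSubset U d X
smallSubset (true ∷ U)  zero    (true ∷ X)  = false
smallSubset (false ∷ U) d       (true ∷ X)  = false

#-false : # {n} (λ _ → false) ≡ 0
#-false {zero}  = refl
#-false {suc n} = cong₂ _+_ (#-false {n}) (#-false {n})

#-smallSubset : (U : Subset n) (d : ℕ) → # (smallSubset U d) ≤ suc ∣ U ∣ ^ d
#-smallSubset []          d       = m^n>0 1 d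
#-smallSubset {suc n} (false ∷ U) d rewrite #-false {n} = #-smallSubset U d
#-smallSubset {suc n} (true ∷ U) zero rewrite #-false {n} = #-smallSubset U 0
#-smallSubset (true ∷ U)  (suc d) = begin
  # (smallSubset U d) + # (smallSubset U (suc d))  ≤⟨ +-mono-≤ (#-smallSubset U d) (#-smallSubset U (suc d)) ⟩
  -- Pascal's rule, with powers in place of the binomial sums.
  suc u ^ d + suc u * suc u ^ d                    ≤⟨ *-monoʳ-≤ (suc (suc u)) (^-monoˡ-≤ d (n≤1+n (suc u))) ⟩
  suc (suc u) ^ suc d                              ∎
  where
  open ≤-Reasoning
  u = ∣ U ∣

smallSubset-true : (U X : Subset n) (d : ℕ) → X ⊆ U → ∣ X ∣ ≤ d → smallSubset U d X ≡ true
smallSubset-true []          []          d       X⊆U X≤d       = refl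
smallSubset-true (u ∷ U)     (false ∷ X) d       X⊆U X≤d       = smallSubset-true U X d (Subset.drop-∷-⊆ X⊆U) X≤d
smallSubset-true (true ∷ U)  (true ∷ X)  (suc d) X⊆U (s≤s X≤d) = smallSubset-true U X d (Subset.drop-∷-⊆ X⊆U) X≤d
smallSubset-true (false ∷ U) (true ∷ X)  d       X⊆U X≤d       = case X⊆U Data.Vec.here of λ ()

differ : Bool → Bool → ℕ
differ true  true  = 0
differ true  false = 1
differ false true  = 1
differ false false = 0

differ-≡ : ∀ {a b} → a ≡ b → differ a b ≡ 0
differ-≡ {true}  refl = refl
differ-≡ {false} refl = refl

differ-≢ : ∀ {a b} → a ≢ b → differ a b ≡ 1
differ-≢ {true}  {true}  a≢b = contradiction refl a≢b
differ-≢ {true}  {false} a≢b = refl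
differ-≢ {false} {true}  a≢b = refl
differ-≢ {false} {false} a≢b = contradiction refl a≢b

differ-triangle : ∀ a b c → differ a c ≤ differ a b + differ b c
differ-triangle true  true  c     = ≤-refl
differ-triangle true  false true  = z≤n
differ-triangle true  false false = ≤-refl
differ-triangle false true  true  = ≤-refl
differ-triangle false true  false = z≤n
differ-triangle false false c     = ≤-refl

differ-sym : ∀ a b → differ a b ≡ differ b a
differ-sym true  true  = refl
differ-sym true  false = refl
differ-sym false true  = refl
differ-sym false false = refl

hamming : Subset n → Subset n → ℕ
hamming s t = sum λ i → differ (lookup s i) (lookup t i)

∣p∪q∣≤∣p∣+∣q∣ : (p q : Subset n) → ∣ p ∪ q ∣ ≤ ∣ p ∣ + ∣ q ∣
∣p∪q∣≤∣p∣+∣q∣ []          []          = z≤n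
∣p∪q∣≤∣p∣+∣q∣ (true ∷ p)  (true ∷ q)  = s≤s (≤-trans (∣p∪q∣≤∣p∣+∣q∣ p q) (+-monoʳ-≤ ∣ p ∣ (n≤1+n ∣ q ∣)))
∣p∪q∣≤∣p∣+∣q∣ (true ∷ p)  (false ∷ q) = s≤s (∣p∪q∣≤∣p∣+∣q∣ p q)
∣p∪q∣≤∣p∣+∣q∣ (false ∷ p) (true ∷ q)  =
  ≤-trans (s≤s (∣p∪q∣≤∣p∣+∣q∣ p q)) (≤-reflexive (sym (+-suc ∣ p ∣ ∣ q ∣)))
∣p∪q∣≤∣p∣+∣q∣ (false ∷ p) (false ∷ q) = ∣p∪q∣≤∣p∣+∣q∣ p q

module _ {N : ℕ} (S : Fin N → Subset n) where

  FamilyVC≤ : ℕ → Set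
  FamilyVC≤ d = ∀ X → (∀ Y → Y ⊆ X → ∃ λ g → X ∩ S g ≡ Y) → ∣ X ∣ ≤ d

  -- Pajor's argument: the traces on `U` are exactly as many as the sets they shatter in the
  -- recursive sense. Such a set lies in `U` and is shattered by the whole family, so it has at most
  -- `d` elements.
  sauer-shelah : ∀ d → FamilyVC≤ d → ∀ U (xs : List (Fin N)) →
                 AllPairs (λ x y → U ∩ S x ≢ U ∩ S y) xs → length xs ≤ suc ∣ U ∣ ^ d
  sauer-shelah d vc U xs distinct = begin
    length xs              ≤⟨ distinct⇒length≤# (λ x → U ∩ S x) trace xs distinct (All.universal (λ x → trace-complete x) xs) ⟩
    # trace                ≡⟨ #-shattered trace ⟩
    # (shattered trace)    ≤⟨ #-mono shattered⇒small ⟩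
    # (smallSubset U d)    ≤⟨ #-smallSubset U d ⟩
    suc ∣ U ∣ ^ d          ∎
    where
    open ≤-Reasoning
    trace? : Decidable (λ v → ∃ λ g → U ∩ S g ≡ v)
    trace? v = Fin.any? (λ g → Vec.≡-dec Bool._≟_ (U ∩ S g) v)
    trace : Vec Bool n → Bool
    trace v = does (trace? v)
    trace-complete : ∀ x → trace (U ∩ S x) ≡ true
    trace-complete x with trace? (U ∩ S x)
    ... | yes _ = refl
    ... | no ¬p = contradiction (x , refl) ¬p
    trace-sound : ∀ v → trace v ≡ true → ∃ λ g → U ∩ S g ≡ v
    trace-sound v h with yes p ← trace? v = p
    shattered⇒small : ∀ X → shattered trace X ≡ true → smallSubset U d X ≡ true
    shattered⇒small X h = smallSubset-true U X d X⊆U (vc X shatters)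
      where
      cut : ∀ Y → Y ⊆ X → ∃ λ g → X ∩ (U ∩ S g) ≡ Y
      cut Y Y⊆X with v , tv , eq ← shattered-trace trace X h Y Y⊆X
        with g , refl ← trace-sound v tv = g , eq
      -- The cut with `Y = X` exhibits one trace containing all of `X`, and traces lie in `U`.
      X⊆U : X ⊆ U
      X⊆U {x} x∈X with g , eq ← cut X id =
        Subset.p∩q⊆p U (S g) (Subset.p∩q⊆q X (U ∩ S g) (subst (x ∈_) (sym eq) x∈X))
      shatters : ∀ Y → Y ⊆ X → ∃ λ g → X ∩ S g ≡ Y
      shatters Y Y⊆X with g , refl ← cut Y Y⊆X = g , Subset.⊆-antisym
        (λ x∈ → let x∈X , x∈S = Subset.x∈p∩q⁻ X (S g) x∈ in
                Subset.x∈p∩q⁺ (x∈X , Subset.x∈p∩q⁺ (X⊆U x∈X , x∈S)))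
        (λ x∈ → let x∈X , x∈US = Subset.x∈p∩q⁻ X (U ∩ S g) x∈ in
                Subset.x∈p∩q⁺ (x∈X , Subset.p∩q⊆q U (S g) x∈US))

  -- Packing: separated sets are told apart by few coordinates

  Resolved : Subset n → Fin N × Fin N → Set
  Resolved U (x , y) = ∃ λ i → i ∈ U × lookup (S x) i ≢ lookup (S y) i

  resolved⇒≢ : ∀ U {x y} → Resolved U (x , y) → U ∩ S x ≢ U ∩ S y
  resolved⇒≢ U {x} {y} (i , i∈U , ne) eq = ne (begin
    lookup (S x) i                  ≡⟨ sym (restrict x) ⟩
    lookup (U ∩ S x) i              ≡⟨ cong (λ v → lookup v i) eq ⟩
    lookup (U ∩ S y) i              ≡⟨ restrict y ⟩
    lookup (S y) i                  ∎)
    where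
    open ≡-Reasoning
    restrict : ∀ z → lookup (U ∩ S z) i ≡ lookup (S z) i
    restrict z = trans (Vec.lookup-zipWith _∧_ i U (S z))
                       (cong (_∧ lookup (S z) i) (Vec.[]=⇒lookup i∈U))

  agree? : ∀ i → Decidable (λ ((x , y) : Fin N × Fin N) → lookup (S x) i ≡ lookup (S y) i)
  agree? i (x , y) = lookup (S x) i Bool.≟ lookup (S y) i

  disagreements : Fin n → List (Fin N × Fin N) → ℕ
  disagreements i []             = 0
  disagreements i ((x , y) ∷ ps) = differ (lookup (S x) i) (lookup (S y) i) + disagreements i ps

  disagreements+agreements : ∀ i ps → disagreements i ps + length (filter (agree? i) ps) ≡ length ps
  disagreements+agreements i []             = refl
  disagreements+agreements i ((x , y) ∷ ps) with agree? i (x , y)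
  ... | yes a≡b rewrite differ-≡ a≡b = trans (+-suc _ _) (cong suc (disagreements+agreements i ps))
  ... | no  a≢b rewrite differ-≢ a≢b = cong suc (disagreements+agreements i ps)

  module _ (q : ℕ) where

    Separated : Fin N → Fin N → Set
    Separated x y = n < suc q * hamming (S x) (S y)

    many-disagreements : ∀ ps → All (λ (x , y) → Separated x y) ps →
                         suc n * length ps ≤ suc q * sum (λ i → disagreements i ps)
    many-disagreements []             _          = ≤-trans (≤-reflexive (*-zeroʳ (suc n))) z≤n
    many-disagreements ((x , y) ∷ ps) (sep ∷ as) = begin
      suc n * suc (length ps)                              ≡⟨ *-suc (suc n) (length ps) ⟩
      suc n + suc n * length ps                            ≤⟨ +-mono-≤ sep (many-disagreements ps as) ⟩
      suc q * hamming (S x) (S y) + suc q * sum (λ i → disagreements i ps)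
        ≡⟨ sym (*-distribˡ-+ (suc q) (hamming (S x) (S y)) _) ⟩
      suc q * (hamming (S x) (S y) + sum (λ i → disagreements i ps))
        ≡⟨ cong (suc q *_) (sym (∑-distrib-+ (λ i → differ (lookup (S x) i) (lookup (S y) i)) (λ i → disagreements i ps))) ⟩
      suc q * sum (λ i → disagreements i ((x , y) ∷ ps))   ∎
      where open ≤-Reasoning

    -- By double counting, the average coordinate tells apart more than the fraction `1 / suc q` of
    -- the pairs, so some coordinate reaches this fraction.
    resolve-many : ∀ p ps → All (λ (x , y) → Separated x y) (p ∷ ps) →
                   ∃ λ i → length (p ∷ ps) ≤ suc q * disagreements i (p ∷ ps)
    resolve-many p ps as with Fin.any? (λ i → length (p ∷ ps) ≤? suc q * disagreements i (p ∷ ps))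
    ... | yes found = found
    ... | no  none  = ⊥-elim (<-irrefl refl (begin-strict
      -- The strict inequality in `Separated` supplies `suc n` instead of `n`; this also settles
      -- `n = 0`.
      n * L                                             <⟨ m<n+m (n * L) (s≤s z≤n) ⟩
      suc n * L                                         ≤⟨ many-disagreements (p ∷ ps) as ⟩
      suc q * sum (λ i → disagreements i (p ∷ ps))      ≡⟨ *-distribˡ-sum (suc q) (λ i → disagreements i (p ∷ ps)) ⟩
      sum (λ i → suc q * disagreements i (p ∷ ps))      ≤⟨ sum-mono (λ i → <⇒≤ (≰⇒> (λ le → none (i , le)))) ⟩
      sum {n} (λ _ → L)                                 ≡⟨ sum-const n L ⟩
      n * L                                             ∎))
      where
      open ≤-Reasoning
      L = length (p ∷ ps)

    agreements-decay : ∀ m i ps → length ps ≤ suc q * disagreements i ps → q ^ suc m * length ps < suc q ^ suc m →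
                       q ^ m * length (filter (agree? i) ps) < suc q ^ m
    agreements-decay m i ps big lt = *-cancelˡ-< (suc q) _ _ (begin-strict
      suc q * (q ^ m * R)        ≡⟨ swap (suc q) (q ^ m) R ⟩
      q ^ m * (suc q * R)        ≤⟨ *-monoʳ-≤ (q ^ m) few ⟩
      q ^ m * (q * L)            ≡⟨ swap′ q (q ^ m) L ⟩
      q ^ suc m * L              <⟨ lt ⟩
      suc q ^ suc m              ∎)
      where
      open ≤-Reasoning
      R = length (filter (agree? i) ps)
      D = disagreements i ps
      L = length ps
      swap : ∀ a b c → a * (b * c) ≡ b * (a * c)
      swap = solve-∀
      swap′ : ∀ a b c → b * (a * c) ≡ a * b * c
      swap′ = solve-∀
      few : suc q * R ≤ q * L
      few = +-cancelˡ-≤ L _ _ (begin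
        L + suc q * R            ≤⟨ +-monoˡ-≤ (suc q * R) big ⟩
        suc q * D + suc q * R    ≡⟨ sym (*-distribˡ-+ (suc q) D R) ⟩
        suc q * (D + R)          ≡⟨ cong (suc q *_) (disagreements+agreements i ps) ⟩
        L + q * L                ∎)

    resolved-extend : ∀ U i ps → All (Resolved U) (filter (agree? i) ps) → All (Resolved (U ∪ ⁅ i ⁆)) ps
    resolved-extend U i []             _  = []
    resolved-extend U i ((x , y) ∷ ps) rs with agree? i (x , y)
    resolved-extend U i ((x , y) ∷ ps) ((j , j∈U , ne) ∷ rs) | yes _ =
      (j , Subset.p⊆p∪q ⁅ i ⁆ j∈U , ne) ∷ resolved-extend U i ps rs
    resolved-extend U i ((x , y) ∷ ps) rs | no ne =
      (i , Subset.q⊆p∪q U ⁅ i ⁆ (Subset.x∈⁅x⁆ i) , ne) ∷ resolved-extend U i ps rs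

    -- Each greedily chosen point leaves at most the fraction q/(q+1) of the pairs unresolved.
    resolve-all : ∀ m ps → All (λ (x , y) → Separated x y) ps → q ^ m * length ps < suc q ^ m →
                  ∃ λ U → ∣ U ∣ ≤ m × All (Resolved U) ps
    resolve-all m       []       _  _  = Subset.⊥ , ≤-trans (≤-reflexive (Subset.∣⊥∣≡0 n)) z≤n , []
    resolve-all zero    (p ∷ ps) _  (s≤s ())
    resolve-all (suc m) (p ∷ ps) as lt
      with i , big ← resolve-many p ps as
      with U , U≤m , res ← resolve-all m (filter (agree? i) (p ∷ ps)) (All.filter⁺ (agree? i) as)
                             (agreements-decay m i (p ∷ ps) big lt)
      = U ∪ ⁅ i ⁆
      , ≤-trans (∣p∪q∣≤∣p∣+∣q∣ U ⁅ i ⁆)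
          (≤-trans (+-mono-≤ U≤m (≤-reflexive (Subset.∣⁅x⁆∣≡1 i))) (≤-reflexive (+-comm m 1)))
      , resolved-extend U i (p ∷ ps) res

    pairs : List (Fin N) → List (Fin N × Fin N)
    pairs []       = []
    pairs (x ∷ xs) = map (x ,_) xs ++ pairs xs

    length-pairs : ∀ xs → length (pairs xs) ≤ length xs * length xs
    length-pairs []       = z≤n
    length-pairs (x ∷ xs) = begin
      length (map (x ,_) xs ++ pairs xs)     ≡⟨ length-++ (map (x ,_) xs) ⟩
      length (map (x ,_) xs) + length (pairs xs)  ≡⟨ cong (_+ length (pairs xs)) (length-map (x ,_) xs) ⟩
      ℓ + length (pairs xs)                  ≤⟨ +-monoʳ-≤ ℓ (length-pairs xs) ⟩
      ℓ + ℓ * ℓ                              ≤⟨ m≤n+m _ (suc ℓ) ⟩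
      suc ℓ + (ℓ + ℓ * ℓ)                    ≡⟨ cong (λ t → suc ℓ + t) (sym (*-suc ℓ ℓ)) ⟩
      suc ℓ * suc ℓ                          ∎
      where
      open ≤-Reasoning
      ℓ = length xs

    pairs-All : {P : Fin N → Fin N → Set} → ∀ {xs} → AllPairs P xs → All (λ (x , y) → P x y) (pairs xs)
    pairs-All []       = []
    pairs-All (a ∷ as) = All.++⁺ (All.map⁺ a) (pairs-All as)

    pairs-AllPairs : {P : Fin N × Fin N → Set} → ∀ xs → All P (pairs xs) → AllPairs (λ x y → P (x , y)) xs
    pairs-AllPairs []       _  = []
    pairs-AllPairs (x ∷ xs) as =
      All.map⁻ (All.++⁻ˡ (map (x ,_) xs) as) ∷ pairs-AllPairs xs (All.++⁻ʳ (map (x ,_) xs) as)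

    -- Separated sets have distinct traces on at most `m` well chosen coordinates, and Sauer-Shelah
    -- counts traces. The last hypothesis ensures that after `m` greedy choices less than one pair
    -- is left unresolved.
    separated⇒length≤ : ∀ d → FamilyVC≤ d → ∀ m xs → AllPairs Separated xs →
                        q ^ m * (length xs * length xs) < suc q ^ m → length xs ≤ suc m ^ d
    separated⇒length≤ d vc m xs sep lt
      with U , U≤m , res ← resolve-all m (pairs xs) (pairs-All sep)
                             (≤-<-trans (*-monoʳ-≤ (q ^ m) (length-pairs xs)) lt)
      = ≤-trans (sauer-shelah d vc U xs (AllPairs.map (resolved⇒≢ U) (pairs-AllPairs xs res)))
                (^-monoˡ-≤ d (s≤s U≤m))

    -- A separated list is extended greedily; once no further element is far from all its members,
    -- the members are the centres of a cover.
    separated-or-cover : Fin N → ∀ k →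
      (∃ λ xs → length xs ≡ k × AllPairs Separated xs) ⊎
      (∃ λ (x : Fin k → Fin N) → ∀ g → ∃ λ i → suc q * hamming (S g) (S (x i)) ≤ n)
    separated-or-cover e zero = inj₁ ([] , refl , [])
    separated-or-cover e (suc k) with separated-or-cover e k
    ... | inj₂ (x , covers) =
      -- `e` is a dummy centre: the cover is padded to have exactly the prescribed size, which then
      -- does not depend on the family.
      inj₂ ((λ { zero → e ; (suc i) → x i }) , λ g → suc (proj₁ (covers g)) , proj₂ (covers g))
    ... | inj₁ (xs , refl , sep) with Fin.any? (λ g → All.all? (λ y → n <? suc q * hamming (S g) (S y)) xs)
    ...   | yes (g , far) = inj₁ (g ∷ xs , refl , far ∷ sep)
    ...   | no  none      = inj₂ ((λ { zero → e ; (suc i) → List.lookup xs i }) , λ g →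
      let near = All.¬All⇒Any¬ (λ y → n <? suc q * hamming (S g) (S y)) xs (λ far → none (g , far))
      in suc (Any.index near) , ≮⇒≥ (Any.lookup-index near))

    cover-of-size : Fin N → ∀ d → FamilyVC≤ d → ∀ m k → k * k * q ^ m < suc q ^ m → suc m ^ d < k →
                    ∃ λ (x : Fin k → Fin N) → ∀ g → ∃ λ i → suc q * hamming (S g) (S (x i)) ≤ n
    cover-of-size e d vc m k lt big with separated-or-cover e k
    ... | inj₂ cover             = cover
    ... | inj₁ (xs , refl , sep) = contradiction
      (separated⇒length≤ d vc m xs sep (subst (_< suc q ^ m) (*-comm (length xs * length xs) (q ^ m)) lt))
      (<⇒≱ big)

covering-number : ∀ d p → ∃ λ k → ∀ {n N} (S : Fin N → Subset n) → Fin N → FamilyVC≤ S (suc d) →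
                  ∃ λ (x : Fin k → Fin N) → ∀ g → ∃ λ i → suc (suc p) * hamming (S g) (S (x i)) ≤ n
covering-number d p = let m , k , big , lt = polynomial<exponential d p in
  k , λ S e vc → cover-of-size S (suc p) e (suc d) vc m k lt big

-- Matrices over ℤ

Mat : ℕ → Set
Mat n = Fin n → Fin n → ℤ

infixl 7 _·_
infix 8 _ᵀ
infix 4 _≗₂_

_≗₂_ : Mat n → Mat n → Set
U ≗₂ V = ∀ g x → U g x ≡ V g x

_·_ : Mat n → Mat n → Mat n
(U · V) g x = ℤΣ.sum λ y → U g y ℤ.* V y x

_ᵀ : Mat n → Mat n
(U ᵀ) g x = U x g

⟪_,_⟫ : Mat n → Mat n → ℤ
⟪ U , V ⟫ = ℤΣ.sum λ g → ℤΣ.sum λ x → U g x ℤ.* V g x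

-- The square of the Hilbert-Schmidt norm. Submultiplicativity keeps its form, while the triangle
-- inequality acquires factors `2`.
norm : Mat n → ℕ
norm U = sum λ g → sum λ x → sq (U g x)

⟪⟫-cong : {U U′ V V′ : Mat n} → U ≗₂ U′ → V ≗₂ V′ → ⟪ U , V ⟫ ≡ ⟪ U′ , V′ ⟫
⟪⟫-cong p q = ℤΣ.sum-cong-≗ λ g → ℤΣ.sum-cong-≗ λ x → cong₂ ℤ._*_ (p g x) (q g x)

norm-cong : {U V : Mat n} → U ≗₂ V → norm U ≡ norm V
norm-cong p = sum-cong-≗ λ g → sum-cong-≗ λ x → cong sq (p g x)

norm-⟪⟫ : (U : Mat n) → pos (norm U) ≡ ⟪ U , U ⟫
norm-⟪⟫ U = trans (sum-pos (λ g → sum λ x → sq (U g x))) (ℤΣ.sum-cong-≗ λ g →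
            trans (sum-pos (λ x → sq (U g x))) (ℤΣ.sum-cong-≗ λ x → pos-sq (U g x)))

⟪⟫-cauchy-schwarz : (U V : Mat n) → sq ⟪ U , V ⟫ ≤ norm U * norm V
⟪⟫-cauchy-schwarz U V =
  cauchy-schwarz (λ g → ℤΣ.sum λ x → U g x ℤ.* V g x) (λ g → sum λ x → sq (U g x)) (λ g → sum λ x → sq (V g x))
    λ g → cauchy-schwarz (λ x → U g x ℤ.* V g x) (λ x → sq (U g x)) (λ x → sq (V g x))
      λ x → ≤-reflexive (sq-* (U g x) (V g x))

norm-· : (U V : Mat n) → norm (U · V) ≤ norm U * norm V
norm-· U V = begin
  (sum λ g → sum λ x → sq ((U · V) g x))
    ≤⟨ sum-mono (λ g → sum-mono λ x →
         cauchy-schwarz (λ y → U g y ℤ.* V y x) (λ y → sq (U g y)) (λ y → sq (V y x))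
           λ y → ≤-reflexive (sq-* (U g y) (V y x))) ⟩
  (sum λ g → sum λ x → u g * v x)      ≡⟨ sum-cong-≗ (λ g → sym (*-distribˡ-sum (u g) v)) ⟩
  (sum λ g → u g * sum v)              ≡⟨ sym (*-distribʳ-sum (sum v) u) ⟩
  sum u * sum v                        ≡⟨ cong (sum u *_) (∑-comm (λ x y → sq (V y x))) ⟩
  norm U * norm V                      ∎
  where
  open ≤-Reasoning
  u = λ g → sum λ y → sq (U g y)
  v = λ x → sum λ y → sq (V y x)

norm-+-≤ : (U V : Mat n) → norm (λ g x → U g x ℤ.+ V g x) ≤ 2 * norm U + 2 * norm V
norm-+-≤ U V = begin
  norm (λ g x → U g x ℤ.+ V g x)                     ≤⟨ sum-mono (λ g → row g) ⟩
  sum (λ g → 2 * u g + 2 * v g)                      ≡⟨ split u v ⟩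
  2 * norm U + 2 * norm V                            ∎
  where
  open ≤-Reasoning
  u = λ g → sum λ x → sq (U g x)
  v = λ g → sum λ x → sq (V g x)
  split : ∀ {n} (f h : Fin n → ℕ) → sum (λ i → 2 * f i + 2 * h i) ≡ 2 * sum f + 2 * sum h
  split f h = trans (∑-distrib-+ (λ i → 2 * f i) (λ i → 2 * h i))
                    (sym (cong₂ _+_ (*-distribˡ-sum 2 f) (*-distribˡ-sum 2 h)))
  row : ∀ g → sum (λ x → sq (U g x ℤ.+ V g x)) ≤ 2 * u g + 2 * v g
  row g = ≤-trans (sum-mono λ x → sq-+-≤ (U g x) (V g x))
                  (≤-reflexive (split (λ x → sq (U g x)) (λ x → sq (V g x))))

norm-neg : (U : Mat n) → norm (λ g x → ℤ.- U g x) ≡ norm U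
norm-neg U = sum-cong-≗ λ g → sum-cong-≗ λ x → sq-neg (U g x)

·-cong : {U U′ V V′ : Mat n} → U ≗₂ U′ → V ≗₂ V′ → U · V ≗₂ U′ · V′
·-cong p q g x = ℤΣ.sum-cong-≗ λ y → cong₂ ℤ._*_ (p g y) (q y x)

·-assoc : (U V W : Mat n) → (U · V) · W ≗₂ U · (V · W)
·-assoc U V W g x = begin
  (ℤΣ.sum λ y → (ℤΣ.sum λ z → U g z ℤ.* V z y) ℤ.* W y x)
    ≡⟨ ℤΣ.sum-cong-≗ (λ y → ℤΣ.*-distribʳ-sum (W y x) (λ z → U g z ℤ.* V z y)) ⟩
  (ℤΣ.sum λ y → ℤΣ.sum λ z → U g z ℤ.* V z y ℤ.* W y x)
    ≡⟨ ℤΣ.∑-comm (λ y z → U g z ℤ.* V z y ℤ.* W y x) ⟩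
  (ℤΣ.sum λ z → ℤΣ.sum λ y → U g z ℤ.* V z y ℤ.* W y x)
    ≡⟨ ℤΣ.sum-cong-≗ (λ z → trans (ℤΣ.sum-cong-≗ λ y → ℤ.*-assoc (U g z) (V z y) (W y x))
                                  (sym (ℤΣ.*-distribˡ-sum (U g z) (λ y → V z y ℤ.* W y x)))) ⟩
  (ℤΣ.sum λ z → U g z ℤ.* (ℤΣ.sum λ y → V z y ℤ.* W y x))
    ∎
  where open ≡-Reasoning

⟪⟫-adjoint : (U V W : Mat n) → ⟪ U · V , W ⟫ ≡ ⟪ U , W · V ᵀ ⟫
⟪⟫-adjoint U V W = ℤΣ.sum-cong-≗ λ g → begin
  (ℤΣ.sum λ x → (ℤΣ.sum λ y → U g y ℤ.* V y x) ℤ.* W g x)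
    ≡⟨ ℤΣ.sum-cong-≗ (λ x → ℤΣ.*-distribʳ-sum (W g x) (λ y → U g y ℤ.* V y x)) ⟩
  (ℤΣ.sum λ x → ℤΣ.sum λ y → U g y ℤ.* V y x ℤ.* W g x)
    ≡⟨ ℤΣ.∑-comm (λ x y → U g y ℤ.* V y x ℤ.* W g x) ⟩
  (ℤΣ.sum λ y → ℤΣ.sum λ x → U g y ℤ.* V y x ℤ.* W g x)
    ≡⟨ ℤΣ.sum-cong-≗ (λ y → trans (ℤΣ.sum-cong-≗ λ x → trans (ℤ.*-assoc (U g y) (V y x) (W g x))
                                                              (cong (U g y ℤ.*_) (ℤ.*-comm (V y x) (W g x))))
                                  (sym (ℤΣ.*-distribˡ-sum (U g y) (λ x → W g x ℤ.* V y x)))) ⟩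
  (ℤΣ.sum λ y → U g y ℤ.* (ℤΣ.sum λ x → W g x ℤ.* V y x))
    ∎
  where open ≡-Reasoning

-- ‖V·U‖² = ⟨V, V·(U·Uᵀ)⟩, so this is log-convexity of ‖V·Uʲ‖² in j when U is symmetric.
norm-log-convex : (V U : Mat n) → norm (V · U) * norm (V · U) ≤ norm V * norm (V · (U · U ᵀ))
norm-log-convex V U = begin
  sq (pos (norm (V · U)))                ≡⟨ cong sq (trans (norm-⟪⟫ (V · U)) (⟪⟫-adjoint V U (V · U))) ⟩
  sq ⟪ V , (V · U) · U ᵀ ⟫               ≡⟨ cong sq (⟪⟫-cong {U = V} (λ _ _ → refl) (·-assoc V U (U ᵀ))) ⟩
  sq ⟪ V , V · (U · U ᵀ) ⟫               ≤⟨ ⟪⟫-cauchy-schwarz V (V · (U · U ᵀ)) ⟩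
  norm V * norm (V · (U · U ᵀ))          ∎
  where open ≤-Reasoning

-- Word problem in groups, by free reduction

infixl 7 _⊙_

data Word (k : ℕ) : Set where
  var : Fin k → Word k
  ε   : Word k
  _⊙_ : Word k → Word k → Word k
  inv : Word k → Word k

module GroupSolver (G : FinGroup) where
  open FinGroup G renaming (n to N)

  group : Group _ _
  group = record { isGroup = isGroup }

  open Group group using (assoc; identityˡ; identityʳ; inverseˡ; inverseʳ)
  open GroupProperties group using (ε⁻¹≈ε; ⁻¹-anti-homo-∙; ⁻¹-involutive)
  open ≡-Reasoning

  ⟦_⟧ : Word k → (Fin k → Fin N) → Fin N
  ⟦ var i ⟧ ρ = ρ i
  ⟦ ε ⟧     ρ = e
  ⟦ a ⊙ b ⟧ ρ = ⟦ a ⟧ ρ ∙ ⟦ b ⟧ ρ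
  ⟦ inv a ⟧ ρ = ⟦ a ⟧ ρ ⁻¹

  letter : Bool × Fin k → (Fin k → Fin N) → Fin N
  letter (true  , i) ρ = ρ i
  letter (false , i) ρ = ρ i ⁻¹

  ⟦_⟧ₗ : List (Bool × Fin k) → (Fin k → Fin N) → Fin N
  ⟦ [] ⟧ₗ     ρ = e
  ⟦ l ∷ ls ⟧ₗ ρ = letter l ρ ∙ ⟦ ls ⟧ₗ ρ

  push : Bool × Fin k → List (Bool × Fin k) → List (Bool × Fin k)
  push l []                          = l ∷ []
  push (s , i) ((t , j) ∷ ls) with i Fin.≟ j | s | t
  ... | yes _ | true  | false = ls
  ... | yes _ | false | true  = ls
  ... | _     | _     | _     = (s , i) ∷ (t , j) ∷ ls

  -- The flag tells whether the word or its inverse is read, and the list is the already reduced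
  -- word that follows it, so that only `push` ever cancels letters.
  normalise : Bool → Word k → List (Bool × Fin k) → List (Bool × Fin k)
  normalise s     (var i) ls = push (s , i) ls
  normalise s     ε       ls = ls
  normalise true  (a ⊙ b) ls = normalise true a (normalise true b ls)
  normalise false (a ⊙ b) ls = normalise false b (normalise false a ls)
  normalise true  (inv a) ls = normalise false a ls
  normalise false (inv a) ls = normalise true a ls

  push-sound : ∀ l (ls : List (Bool × Fin k)) ρ → ⟦ push l ls ⟧ₗ ρ ≡ letter l ρ ∙ ⟦ ls ⟧ₗ ρ
  push-sound l       []             ρ = refl
  push-sound (s , i) ((t , j) ∷ ls) ρ with i Fin.≟ j | s | t
  ... | no  _    | _     | _     = refl
  ... | yes _    | true  | true  = refl
  ... | yes _    | false | false = refl
  ... | yes refl | true  | false = sym (trans (sym (assoc _ _ _)) (trans (cong (_∙ ⟦ ls ⟧ₗ ρ) (inverseʳ (ρ i))) (identityˡ _)))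
  ... | yes refl | false | true  = sym (trans (sym (assoc _ _ _)) (trans (cong (_∙ ⟦ ls ⟧ₗ ρ) (inverseˡ (ρ i))) (identityˡ _)))

  signed : Bool → Fin N → Fin N
  signed true  x = x
  signed false x = x ⁻¹

  normalise-sound : ∀ s (a : Word k) ls ρ → ⟦ normalise s a ls ⟧ₗ ρ ≡ signed s (⟦ a ⟧ ρ) ∙ ⟦ ls ⟧ₗ ρ
  normalise-sound true  (var i) ls ρ = push-sound (true , i) ls ρ
  normalise-sound false (var i) ls ρ = push-sound (false , i) ls ρ
  normalise-sound true  ε       ls ρ = sym (identityˡ _)
  normalise-sound false ε       ls ρ = sym (trans (cong (_∙ ⟦ ls ⟧ₗ ρ) ε⁻¹≈ε) (identityˡ _))
  normalise-sound true  (a ⊙ b) ls ρ = begin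
    ⟦ normalise true a (normalise true b ls) ⟧ₗ ρ  ≡⟨ normalise-sound true a _ ρ ⟩
    ⟦ a ⟧ ρ ∙ ⟦ normalise true b ls ⟧ₗ ρ           ≡⟨ cong (⟦ a ⟧ ρ ∙_) (normalise-sound true b ls ρ) ⟩
    ⟦ a ⟧ ρ ∙ (⟦ b ⟧ ρ ∙ ⟦ ls ⟧ₗ ρ)                ≡⟨ sym (assoc _ _ _) ⟩
    (⟦ a ⟧ ρ ∙ ⟦ b ⟧ ρ) ∙ ⟦ ls ⟧ₗ ρ                  ∎
  normalise-sound false (a ⊙ b) ls ρ = begin
    ⟦ normalise false b (normalise false a ls) ⟧ₗ ρ  ≡⟨ normalise-sound false b _ ρ ⟩
    (⟦ b ⟧ ρ ⁻¹) ∙ ⟦ normalise false a ls ⟧ₗ ρ         ≡⟨ cong ((⟦ b ⟧ ρ ⁻¹) ∙_) (normalise-sound false a ls ρ) ⟩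
    (⟦ b ⟧ ρ ⁻¹) ∙ ((⟦ a ⟧ ρ ⁻¹) ∙ ⟦ ls ⟧ₗ ρ)            ≡⟨ sym (assoc _ _ _) ⟩
    ((⟦ b ⟧ ρ ⁻¹) ∙ (⟦ a ⟧ ρ ⁻¹)) ∙ ⟦ ls ⟧ₗ ρ              ≡⟨ cong (_∙ ⟦ ls ⟧ₗ ρ) (sym (⁻¹-anti-homo-∙ _ _)) ⟩
    ((⟦ a ⟧ ρ ∙ ⟦ b ⟧ ρ) ⁻¹) ∙ ⟦ ls ⟧ₗ ρ               ∎
  normalise-sound true  (inv a) ls ρ = normalise-sound false a ls ρ
  normalise-sound false (inv a) ls ρ =
    trans (normalise-sound true a ls ρ) (cong (_∙ ⟦ ls ⟧ₗ ρ) (sym (⁻¹-involutive _)))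

  solve : (ρ : Fin k → Fin N) (a b : Word k) → normalise true a [] ≡ normalise true b [] → ⟦ a ⟧ ρ ≡ ⟦ b ⟧ ρ
  solve ρ a b eq = begin
    ⟦ a ⟧ ρ                       ≡⟨ sym (identityʳ _) ⟩
    ⟦ a ⟧ ρ ∙ e                   ≡⟨ sym (normalise-sound true a [] ρ) ⟩
    ⟦ normalise true a [] ⟧ₗ ρ    ≡⟨ cong (λ l → ⟦ l ⟧ₗ ρ) eq ⟩
    ⟦ normalise true b [] ⟧ₗ ρ    ≡⟨ normalise-sound true b [] ρ ⟩
    ⟦ b ⟧ ρ ∙ e                   ≡⟨ identityʳ _ ⟩
    ⟦ b ⟧ ρ                       ∎

-- Left translations of matrices indexed by a group

pattern v₀ = var zero
pattern v₁ = var (suc zero)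
pattern v₂ = var (suc (suc zero))

module Translation (G : FinGroup) where
  open FinGroup G renaming (n to N)

  open GroupSolver G public using (group; solve)
  open Group group using (identityˡ)
  open GroupProperties group public using (\\-leftDividesˡ; \\-leftDividesʳ)

  sum-translate : ∀ h (f : Fin N → ℕ) → sum f ≡ sum (λ g → f (h ∙ g))
  sum-translate h f = sum-reindex f (h ∙_) ((h ⁻¹) ∙_) (\\-leftDividesˡ h) (\\-leftDividesʳ h)

  sumℤ-translate : ∀ h (f : Fin N → ℤ) → ℤΣ.sum f ≡ ℤΣ.sum (λ g → f (h ∙ g))
  sumℤ-translate h f = sumℤ-reindex f (h ∙_) ((h ⁻¹) ∙_) (\\-leftDividesˡ h) (\\-leftDividesʳ h)

  norm-translate : ∀ h (U : Mat N) → norm U ≡ norm (λ g x → U (h ∙ g) x)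
  norm-translate h U = sum-translate h (λ g → sum λ x → sq (U g x))

  D : Fin N → Mat N → Mat N
  D h U g x = U (h ∙ g) x ℤ.- U g x

  D-cong : ∀ h {U V : Mat N} → U ≗₂ V → D h U ≗₂ D h V
  D-cong h p g x = cong₂ ℤ._-_ (p (h ∙ g) x) (p g x)

  D-· : ∀ h (U V : Mat N) → D h (U · V) ≗₂ D h U · V
  D-· h U V g x = trans (sym (sumℤ-minus (λ y → U (h ∙ g) y ℤ.* V y x) (λ y → U g y ℤ.* V y x)))
                        (ℤΣ.sum-cong-≗ λ y → distrib (U (h ∙ g) y) (U g y) (V y x))
    where
    distrib : ∀ a b c → a ℤ.* c ℤ.- b ℤ.* c ≡ (a ℤ.- b) ℤ.* c
    distrib = ℤ-solve-∀

  norm-D-e : ∀ U → norm (D e U) ≡ 0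
  norm-D-e U = begin
    norm (D e U)                        ≡⟨ norm-cong (λ g x → trans (cong (λ h → U h x ℤ.- U g x) (identityˡ g)) (ℤ.+-inverseʳ (U g x))) ⟩
    sum {N} (λ _ → sum {N} λ _ → 0)     ≡⟨ trans (sum-cong-≗ {N} λ _ → trans (sum-const N 0) (*-zeroʳ N)) (trans (sum-const N 0) (*-zeroʳ N)) ⟩
    0                                   ∎
    where open ≡-Reasoning

  norm-D-∙ : ∀ a b U → norm (D (a ∙ b) U) ≤ 2 * norm (D a U) + 2 * norm (D b U)
  norm-D-∙ a b U = begin
    norm (D (a ∙ b) U)
      ≡⟨ norm-cong (λ g x → trans (cong (λ h → U h x ℤ.- U g x) (Group.assoc group a b g))
                                  (telescope (U (a ∙ (b ∙ g)) x) (U (b ∙ g) x) (U g x))) ⟩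
    norm (λ g x → D a U (b ∙ g) x ℤ.+ D b U g x)
      ≤⟨ norm-+-≤ (λ g x → D a U (b ∙ g) x) (D b U) ⟩
    2 * norm (λ g x → D a U (b ∙ g) x) + 2 * norm (D b U)
      ≡⟨ cong (λ t → 2 * t + 2 * norm (D b U)) (sym (norm-translate b (D a U))) ⟩
    2 * norm (D a U) + 2 * norm (D b U)
      ∎
    where
    open ≤-Reasoning
    telescope : ∀ p q r → p ℤ.- r ≡ (p ℤ.- q) ℤ.+ (q ℤ.- r)
    telescope = ℤ-solve-∀

  norm-D-⁻¹ : ∀ a U → norm (D (a ⁻¹) U) ≡ norm (D a U)
  norm-D-⁻¹ a U = begin
    norm (D (a ⁻¹) U)                          ≡⟨ norm-translate a (D (a ⁻¹) U) ⟩
    norm (λ g x → U ((a ⁻¹) ∙ (a ∙ g)) x ℤ.- U (a ∙ g) x)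
      ≡⟨ norm-cong (λ g x → trans (cong (λ h → U h x ℤ.- U (a ∙ g) x) (\\-leftDividesʳ a g)) (swap (U g x) (U (a ∙ g) x))) ⟩
    norm (λ g x → ℤ.- D a U g x)               ≡⟨ norm-neg (D a U) ⟩
    norm (D a U)                               ∎
    where
    open ≡-Reasoning
    swap : ∀ p q → p ℤ.- q ≡ ℤ.- (q ℤ.- p)
    swap = ℤ-solve-∀

  Invariant : Mat N → Set
  Invariant U = ∀ k g x → U (k ∙ g) (k ∙ x) ≡ U g x

  ·-invariant : ∀ {U V} → Invariant U → Invariant V → Invariant (U · V)
  ·-invariant {U} {V} iU iV k g x =
    trans (sumℤ-translate k (λ y → U (k ∙ g) y ℤ.* V y (k ∙ x)))
          (ℤΣ.sum-cong-≗ λ y → cong₂ ℤ._*_ (iU k g y) (iV k y x))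

  norm-D-conj : ∀ {U} → Invariant U → ∀ x a → norm (D ((x ∙ a) ∙ (x ⁻¹)) U) ≡ norm (D a U)
  norm-D-conj {U} iU x a = begin
    norm (D c U)                                        ≡⟨ norm-translate x (D c U) ⟩
    norm (λ g y → D c U (x ∙ g) y)                      ≡⟨ sum-cong-≗ (λ g → sum-translate x (λ y → sq (D c U (x ∙ g) y))) ⟩
    norm (λ g y → D c U (x ∙ g) (x ∙ y))                ≡⟨ norm-cong (λ g y → cong₂ ℤ._-_
      (trans (cong (λ h → U h (x ∙ y)) (solve (lookup (x ∷ a ∷ g ∷ [])) (((v₀ ⊙ v₁) ⊙ inv v₀) ⊙ (v₀ ⊙ v₂)) (v₀ ⊙ (v₁ ⊙ v₂)) refl))
             (iU x (a ∙ g) y))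
      (iU x g y)) ⟩
    norm (D a U)                                        ∎
    where
    open ≡-Reasoning
    c = (x ∙ a) ∙ (x ⁻¹)

  D-·-commute : ∀ {U} → Invariant U → ∀ h V → D h U · V ≗₂ U · D h V
  D-·-commute {U} iU h V g x = begin
    (D h U · V) g x                                   ≡⟨ sym (D-· h U V g x) ⟩
    (U · V) (h ∙ g) x ℤ.- (U · V) g x
      ≡⟨ cong (ℤ._- (U · V) g x) (trans (sumℤ-translate h (λ y → U (h ∙ g) y ℤ.* V y x))
                                         (ℤΣ.sum-cong-≗ λ y → cong (ℤ._* V (h ∙ y) x) (iU h g y))) ⟩
    ℤΣ.sum (λ y → U g y ℤ.* V (h ∙ y) x) ℤ.- (U · V) g x
      ≡⟨ sym (sumℤ-minus (λ y → U g y ℤ.* V (h ∙ y) x) (λ y → U g y ℤ.* V y x)) ⟩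
    ℤΣ.sum (λ y → U g y ℤ.* V (h ∙ y) x ℤ.- U g y ℤ.* V y x)
      ≡⟨ ℤΣ.sum-cong-≗ (λ y → distrib (U g y) (V (h ∙ y) x) (V y x)) ⟩
    (U · D h V) g x                                   ∎
    where
    open ≡-Reasoning
    distrib : ∀ a b c → a ℤ.* b ℤ.- a ℤ.* c ≡ a ℤ.* (b ℤ.- c)
    distrib = ℤ-solve-∀

  -- Since `U` commutes with translations, the inner difference can be moved to the right factor of
  -- `U · U` and the outer one kept on the left: the matrix is the product of `D g U` and `D h U`.
  norm-D-D : ∀ {U} → Invariant U → ∀ g h → norm (D g (D h (U · U))) ≤ norm (D g U) * norm (D h U)
  norm-D-D {U} iU g h = ≤-trans (≤-reflexive (norm-cong factor)) (norm-· (D g U) (D h U))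
    where
    factor : D g (D h (U · U)) ≗₂ D g U · D h U
    factor y x = trans (D-cong g (λ y x → trans (D-· h U U y x) (D-·-commute iU h U y x)) y x) (D-· g U (D h U) y x)

  -- The second differences of `V` by `a ⁻¹` and `b ⁻¹`, taken in the two orders, share all terms
  -- but one. What remains, evaluated at `(a ∙ b) ∙ g`, is the difference by the commutator at `g`.
  norm-D-commutator : ∀ {U} → Invariant U → ∀ a b →
                      norm (D (commutator G a b) (U · U)) ≤ 4 * (norm (D a U) * norm (D b U))
  norm-D-commutator {U} iU a b = begin
    norm (D (commutator G a b) V)                                 ≡⟨ sym (norm-cong cancel) ⟩
    norm (λ g x → W ((a ∙ b) ∙ g) x)                              ≡⟨ sym (norm-translate (a ∙ b) W) ⟩
    norm W                                                        ≤⟨ norm-+-≤ (D b′ (D a′ V)) (λ g x → ℤ.- D a′ (D b′ V) g x) ⟩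
    2 * norm (D b′ (D a′ V)) + 2 * norm (λ g x → ℤ.- D a′ (D b′ V) g x)
      ≡⟨ cong (λ t → 2 * norm (D b′ (D a′ V)) + 2 * t) (norm-neg (D a′ (D b′ V))) ⟩
    2 * norm (D b′ (D a′ V)) + 2 * norm (D a′ (D b′ V))           ≤⟨ +-mono-≤ (*-monoʳ-≤ 2 (norm-D-D iU b′ a′)) (*-monoʳ-≤ 2 (norm-D-D iU a′ b′)) ⟩
    2 * (norm (D b′ U) * norm (D a′ U)) + 2 * (norm (D a′ U) * norm (D b′ U))
      ≡⟨ cong₂ (λ s t → 2 * (t * s) + 2 * (s * t)) (norm-D-⁻¹ a U) (norm-D-⁻¹ b U) ⟩
    2 * (norm (D b U) * norm (D a U)) + 2 * (norm (D a U) * norm (D b U))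
      ≡⟨ collect (norm (D a U)) (norm (D b U)) ⟩
    4 * (norm (D a U) * norm (D b U))                             ∎
    where
    open ≤-Reasoning
    V = U · U
    a′ = a ⁻¹
    b′ = b ⁻¹
    W : Mat N
    W g x = D b′ (D a′ V) g x ℤ.+ ℤ.- D a′ (D b′ V) g x
    collect : ∀ s t → 2 * (t * s) + 2 * (s * t) ≡ 4 * (s * t)
    collect = solve-∀
    fourTerms : ∀ p q r s t → (p ℤ.- q ℤ.- (r ℤ.- s)) ℤ.+ ℤ.- (t ℤ.- r ℤ.- (q ℤ.- s)) ≡ p ℤ.- t
    fourTerms = ℤ-solve-∀
    cancel : (λ g x → W ((a ∙ b) ∙ g) x) ≗₂ D (commutator G a b) V
    cancel g x = trans
      (fourTerms (V (a′ ∙ (b′ ∙ ((a ∙ b) ∙ g))) x) _ _ (V ((a ∙ b) ∙ g) x) _)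
      (cong₂ (λ p q → V p x ℤ.- V q x)
        (solve (lookup (a ∷ b ∷ g ∷ [])) (inv v₀ ⊙ (inv v₁ ⊙ ((v₀ ⊙ v₁) ⊙ v₂))) (((inv v₀ ⊙ inv v₁) ⊙ (v₀ ⊙ v₁)) ⊙ v₂) refl)
        (solve (lookup (a ∷ b ∷ g ∷ [])) (inv v₁ ⊙ (inv v₀ ⊙ ((v₀ ⊙ v₁) ⊙ v₂))) v₂ refl))

  Symmetric : Mat N → Set
  Symmetric U = U ᵀ ≗₂ U

  ·-symmetric : ∀ {U} → Symmetric U → Symmetric (U · U)
  ·-symmetric {U} sU g x = ℤΣ.sum-cong-≗ λ y →
    trans (ℤ.*-comm (U x y) (U y g)) (cong₂ ℤ._*_ (sU g y) (sU y x))

-- Spectral gap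

module SpectralGap (G : FinGroup) (M : Mat (FinGroup.n G)) (M-invariant : Translation.Invariant G M) where
  open FinGroup G renaming (n to N)
  open Translation G

  F : Mat N
  F = M · M ᵀ

  -- `Q k` is `F ^ (2 ^ k)`. Squaring matches the commutator estimate, which passes from `U` to
  -- `U · U`.
  Q : ℕ → Mat N
  Q zero    = F
  Q (suc k) = Q k · Q k

  Q-invariant : ∀ k → Invariant (Q k)
  Q-invariant zero    = ·-invariant M-invariant (λ k g x → M-invariant k x g)
  Q-invariant (suc k) = ·-invariant (Q-invariant k) (Q-invariant k)

  Q-symmetric : ∀ k → Symmetric (Q k)
  Q-symmetric zero    g x = ℤΣ.sum-cong-≗ λ y → ℤ.*-comm (M x y) (M g y)
  Q-symmetric (suc k) = ·-symmetric (Q-symmetric k)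

  module _ (h : Fin N) where

    private
      b₁ = norm (D h M)
      b₂ = norm (D h F)
      b₃ = norm (D h F · M)
      A : ℕ → ℕ
      A k = norm (D h F · Q k)

    -- Log-convexity at the exponents `1`, `1 + 2 ^ k` and `1 + 2 ^ (k + 1)` of `F`.
    A-convex : ∀ k → A k * A k ≤ b₂ * A (suc k)
    A-convex k = ≤-trans (norm-log-convex (D h F) (Q k))
      (≤-reflexive (cong (b₂ *_) (norm-cong (·-cong {U = D h F} (λ _ _ → refl) (·-cong {U = Q k} (λ _ _ → refl) (Q-symmetric k))))))

    A-iterate : .{{ℕ.NonZero b₂}} → ∀ k → A 0 ^ (2 ^ k) * b₂ ≤ b₂ ^ (2 ^ k) * A k
    A-iterate zero    = ≤-reflexive (trans (cong (_* b₂) (*-identityʳ (A 0)))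
      (trans (*-comm (A 0) b₂) (cong (_* A 0) (sym (*-identityʳ b₂)))))
    A-iterate (suc k) = *-cancelʳ-≤ _ _ b₂ (begin
      A 0 ^ (2 ^ suc k) * b₂ * b₂                      ≡⟨ cong (λ t → t * b₂ * b₂) (double (A 0) (2 ^ k)) ⟩
      X * X * b₂ * b₂                                  ≡⟨ square X b₂ ⟩
      (X * b₂) * (X * b₂)                              ≤⟨ *-mono-≤ (A-iterate k) (A-iterate k) ⟩
      (Y * A k) * (Y * A k)                            ≡⟨ regroup Y (A k) ⟩
      Y * Y * (A k * A k)                              ≤⟨ *-monoʳ-≤ (Y * Y) (A-convex k) ⟩
      Y * Y * (b₂ * A (suc k))                         ≡⟨ regroup′ (Y * Y) b₂ (A (suc k)) ⟩
      Y * Y * A (suc k) * b₂                           ≡⟨ cong (λ t → t * A (suc k) * b₂) (sym (double b₂ (2 ^ k))) ⟩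
      b₂ ^ (2 ^ suc k) * A (suc k) * b₂                ∎)
      where
      open ≤-Reasoning
      X = A 0 ^ (2 ^ k)
      Y = b₂ ^ (2 ^ k)
      double : ∀ x e → x ^ (e + (e + 0)) ≡ x ^ e * x ^ e
      double x e = trans (cong (λ t → x ^ (e + t)) (+-identityʳ e)) (^-distribˡ-+-* x e e)
      square : ∀ x b → x * x * b * b ≡ (x * b) * (x * b)
      square = solve-∀
      regroup : ∀ y a → (y * a) * (y * a) ≡ y * y * (a * a)
      regroup = solve-∀
      regroup′ : ∀ y b a → y * (b * a) ≡ y * a * b
      regroup′ = solve-∀

    module _ (C r : ℕ) (small : ∀ k → norm (D h (Q k)) ≤ C * r ^ (2 ^ k)) where

      A-small : ∀ k → A k ≤ norm F * C * r ^ (2 ^ k)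
      A-small k = begin
        norm (D h F · Q k)               ≡⟨ norm-cong (D-·-commute (Q-invariant 0) h (Q k)) ⟩
        norm (F · D h (Q k))             ≤⟨ norm-· F (D h (Q k)) ⟩
        norm F * norm (D h (Q k))        ≤⟨ *-monoʳ-≤ (norm F) (small k) ⟩
        norm F * (C * r ^ (2 ^ k))       ≡⟨ sym (*-assoc (norm F) C _) ⟩
        norm F * C * r ^ (2 ^ k)         ∎
        where open ≤-Reasoning

      -- Combining `A-iterate` with `A-small` gives `A 0 ^ (2 ^ k) ≤ norm F * C * (r * b₂) ^ (2 ^
      -- k)` for every `k`. The factor in front, however large, cannot affect the comparison of the
      -- bases.
      A₀≤ : A 0 ≤ r * b₂
      A₀≤ with b₂ in eq
      ... | zero  = ≤-trans (norm-· (D h F) F) (≤-trans (≤-reflexive (cong (_* norm F) eq)) z≤n)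
      ... | suc _ = ^2^k-cancel-≤ (A 0) (r * suc _) (norm F * C) λ k → begin
        A 0 ^ (2 ^ k)                                  ≤⟨ m≤m*n (A 0 ^ (2 ^ k)) b₂ {{b₂≢0}} ⟩
        A 0 ^ (2 ^ k) * b₂                             ≤⟨ A-iterate {{b₂≢0}} k ⟩
        b₂ ^ (2 ^ k) * A k                             ≤⟨ *-monoʳ-≤ (b₂ ^ (2 ^ k)) (A-small k) ⟩
        b₂ ^ (2 ^ k) * (norm F * C * r ^ (2 ^ k))      ≡⟨ regroup (b₂ ^ (2 ^ k)) (norm F * C) (r ^ (2 ^ k)) ⟩
        norm F * C * (r ^ (2 ^ k) * b₂ ^ (2 ^ k))      ≡⟨ cong (norm F * C *_) (sym (^-distrib-* r b₂ (2 ^ k))) ⟩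
        norm F * C * (r * b₂) ^ (2 ^ k)                ≡⟨ cong (λ t → norm F * C * (r * t) ^ (2 ^ k)) eq ⟩
        norm F * C * (r * suc _) ^ (2 ^ k)             ∎
        where
        open ≤-Reasoning
        b₂≢0 : ℕ.NonZero b₂
        b₂≢0 = subst ℕ.NonZero (sym eq) _
        regroup : ∀ y c z → y * (c * z) ≡ c * (z * y)
        regroup = solve-∀

      -- With `M` counted as a square root of `F`, the numbers `b₁`, `b₂`, `b₃`, `A 0` belong to the
      -- exponents `1/2`, `1`, `3/2`, `2`. Log-convexity carries the ratio bound between the last
      -- ones down to `b₁` and `b₂`.
      norm-gap : b₂ * b₂ ≤ r * (b₁ * b₁)
      norm-gap with b₂ * b₂ in eq
      ... | zero  = z≤n
      ... | suc w = *-cancelʳ-≤ (suc w) (r * (b₁ * b₁)) (suc w) (begin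
        suc w * suc w                       ≡⟨ cong₂ _*_ (sym eq) (sym eq) ⟩
        (b₂ * b₂) * (b₂ * b₂)               ≤⟨ *-mono-≤ lower lower ⟩
        (b₁ * b₃) * (b₁ * b₃)               ≡⟨ regroup b₁ b₃ ⟩
        b₁ * b₁ * (b₃ * b₃)                 ≤⟨ *-monoʳ-≤ (b₁ * b₁) (norm-log-convex (D h F) M) ⟩
        b₁ * b₁ * (b₂ * A 0)                ≤⟨ *-monoʳ-≤ (b₁ * b₁) (*-monoʳ-≤ b₂ A₀≤) ⟩
        b₁ * b₁ * (b₂ * (r * b₂))           ≡⟨ regroup′ b₁ b₂ r ⟩
        r * (b₁ * b₁) * (b₂ * b₂)           ≡⟨ cong (r * (b₁ * b₁) *_) eq ⟩
        r * (b₁ * b₁) * suc w               ∎)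
        where
        open ≤-Reasoning
        regroup : ∀ x y → (x * y) * (x * y) ≡ x * x * (y * y)
        regroup = solve-∀
        regroup′ : ∀ x y r → x * x * (y * (r * y)) ≡ r * (x * x) * (y * y)
        regroup′ = solve-∀
        lower : b₂ * b₂ ≤ b₁ * b₃
        lower = begin
          b₂ * b₂                                          ≡⟨ cong (λ t → t * t) (norm-cong (D-· h M (M ᵀ))) ⟩
          norm (D h M · M ᵀ) * norm (D h M · M ᵀ)          ≤⟨ norm-log-convex (D h M) (M ᵀ) ⟩
          b₁ * norm (D h M · (M ᵀ · M))                    ≡⟨ cong (b₁ *_) (norm-cong λ g x →
            trans (sym (·-assoc (D h M) (M ᵀ) M g x)) (·-cong {V = M} (λ g x → sym (D-· h M (M ᵀ) g x)) (λ _ _ → refl) g x)) ⟩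
          b₁ * b₃                                          ∎

-- Generated subgroups

fromDec : {P : Fin n → Set} → Decidable P → Subset n
fromDec P? = tabulate (does ∘ P?)

∈-fromDec⁺ : {P : Fin n → Set} (P? : Decidable P) → ∀ {x} → P x → x ∈ fromDec P?
∈-fromDec⁺ P? {x} px = Vec.lookup⇒[]= x _ (trans (Vec.lookup∘tabulate _ x) (dec-true (P? x) px))

∈-fromDec⁻ : {P : Fin n → Set} (P? : Decidable P) → ∀ {x} → x ∈ fromDec P? → P x
∈-fromDec⁻ P? {x} x∈ with P? x | trans (sym (Vec.lookup∘tabulate (does ∘ P?) x)) (Vec.[]=⇒lookup x∈)
... | yes px | _ = px

module Generation (G : FinGroup) where
  open FinGroup G renaming (n to N)
  open Translation G hiding (D)
  open Group group using (assoc; identityˡ)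

  infix 9 _^^_

  _^^_ : (Fin N → Set) → ℕ → Fin N → Set
  (P ^^ zero)  x = x ≡ e
  (P ^^ suc l) x = ∃ λ s → P s × (P ^^ l) ((s ⁻¹) ∙ x)

  Gen : (Fin N → Set) → Fin N → Set
  Gen P x = ∃ λ l → (P ^^ l) x

  ^^-dec : {P : Fin N → Set} → Decidable P → ∀ l → Decidable (P ^^ l)
  ^^-dec P? zero    x = x Fin.≟ e
  ^^-dec P? (suc l) x = Fin.any? λ s → P? s ×-dec ^^-dec P? l ((s ⁻¹) ∙ x)

  ^^-map : {P R : Fin N → Set} → (∀ {s} → P s → R s) → ∀ l {x} → (P ^^ l) x → (R ^^ l) x
  ^^-map f zero    w             = w
  ^^-map f (suc l) (s , Ps , w) = s , f Ps , ^^-map f l w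

  ^^-∙ : {P : Fin N → Set} → ∀ l m {x y} → (P ^^ l) x → (P ^^ m) y → (P ^^ (l + m)) (x ∙ y)
  ^^-∙ {P} zero    m {y = y}         refl         w′ = subst (P ^^ m) (sym (identityˡ y)) w′
  ^^-∙ {P} (suc l) m {x} {y} (s , Ps , w) w′ =
    s , Ps , subst (P ^^ (l + m)) (assoc (s ⁻¹) x y) (^^-∙ l m w w′)

  ^^-suc : {P : Fin N → Set} → P e → ∀ l {x} → (P ^^ l) x → (P ^^ suc l) x
  ^^-suc {P} Pe l {x} w = e , Pe , subst (P ^^ l) (solve (lookup (x ∷ [])) v₀ (inv ε ⊙ v₀) refl) w

  ^^-mono : {P : Fin N → Set} → P e → ∀ {l m} → l ≤ m → ∀ {x} → (P ^^ l) x → (P ^^ m) x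
  ^^-mono {P} Pe {l} l≤m {x} w with o , refl ← m≤n⇒∃[o]m+o≡n l≤m = go o
    where
    go : ∀ o → (P ^^ (l + o)) x
    go zero    = subst (λ t → (P ^^ t) x) (sym (+-identityʳ l)) w
    go (suc o) = subst (λ t → (P ^^ t) x) (sym (+-suc l o)) (^^-suc Pe (l + o) (go o))

  module _ {P : Fin N → Set} (P? : Decidable P) (Pe : P e) where

    private
      Stable : ℕ → Set
      Stable j = ∀ x → (P ^^ suc j) x → (P ^^ j) x

    stable-or-grows : ∀ l → (∃ λ j → j ≤ l × Stable j) ⊎ (l < ∣ fromDec (^^-dec P? l) ∣)
    stable-or-grows zero = inj₂ (≤-trans (≤-reflexive (sym (Subset.∣⁅x⁆∣≡1 e)))
      (Subset.p⊆q⇒∣p∣≤∣q∣ λ x∈ → ∈-fromDec⁺ (^^-dec P? 0) (Subset.x∈⁅y⁆⇒x≡y e x∈)))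
    stable-or-grows (suc l) with stable-or-grows l
    ... | inj₁ (j , j≤l , st) = inj₁ (j , m≤n⇒m≤1+n j≤l , st)
    ... | inj₂ grown with Fin.all? (λ x → ^^-dec P? (suc l) x →-dec ^^-dec P? l x)
    ...   | yes st = inj₁ (l , n≤1+n l , st)
    ...   | no  ¬st = inj₂ (≤-<-trans grown (Subset.p⊂q⇒∣p∣<∣q∣
      ( (λ x∈ → ∈-fromDec⁺ (^^-dec P? (suc l)) (^^-suc Pe l (∈-fromDec⁻ (^^-dec P? l) x∈)))
      , fresh )))
      where
      fresh : ∃ λ x → x ∈ fromDec (^^-dec P? (suc l)) × x ∉ fromDec (^^-dec P? l)
      fresh with x , ¬imp ← Fin.¬∀⟶∃¬ N _ (λ x → ^^-dec P? (suc l) x →-dec ^^-dec P? l x) ¬st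
        with ^^-dec P? (suc l) x
      ... | yes w = x , ∈-fromDec⁺ (^^-dec P? (suc l)) w , λ x∈ → ¬imp (λ _ → ∈-fromDec⁻ (^^-dec P? l) x∈)
      ... | no ¬w = contradiction (λ w → contradiction w ¬w) ¬imp

    -- The balls around `e` grow strictly until they become stable, and none has more than `N`
    -- elements. This makes generated subgroups decidable and provides one word length for all
    -- generating sets.
    short-words : ∀ {x} → Gen P x → (P ^^ N) x
    short-words (m , w) with stable-or-grows N
    ... | inj₂ N<     = contradiction (Subset.∣p∣≤n (fromDec (^^-dec P? N))) (<⇒≱ N<)
    ... | inj₁ (j , j≤N , st) = ^^-mono Pe j≤N (collapse m w)
      where
      collapse : ∀ m {x} → (P ^^ m) x → (P ^^ j) x
      collapse zero    w            = ^^-mono Pe z≤n w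
      collapse (suc m) (s , Ps , w) = st _ (s , Ps , collapse m w)

  ConjClosed InvClosed : (Fin N → Set) → Set
  ConjClosed P = ∀ g {x} → P x → P ((g ∙ x) ∙ (g ⁻¹))
  InvClosed  P = ∀ {x} → P x → P (x ⁻¹)

  Gen-e : ∀ {P} → Gen P e
  Gen-e = 0 , refl

  Gen-∙ : ∀ {P x y} → Gen P x → Gen P y → Gen P (x ∙ y)
  Gen-∙ (l , w) (m , w′) = l + m , ^^-∙ l m w w′

  Gen-incl : ∀ {P x} → P x → Gen P x
  Gen-incl {x = x} Px = 1 , x , Px , Group.inverseˡ group x

  Gen-map : {P R : Fin N → Set} → (∀ {s} → P s → R s) → ∀ {x} → Gen P x → Gen R x
  Gen-map f (l , w) = l , ^^-map f l w

  Gen-conj : ∀ {P} → ConjClosed P → ConjClosed (Gen P)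
  Gen-conj {P} cP g (l , w) = l , go l w
    where
    go : ∀ l {x} → (P ^^ l) x → (P ^^ l) ((g ∙ x) ∙ (g ⁻¹))
    go zero    refl         = solve (lookup (g ∷ [])) ((v₀ ⊙ ε) ⊙ inv v₀) ε refl
    go (suc l) {x} (s , Ps , w) = (g ∙ s) ∙ (g ⁻¹) , cP g Ps ,
      subst (P ^^ l) (solve (lookup (g ∷ s ∷ x ∷ []))
        ((v₀ ⊙ (inv v₁ ⊙ v₂)) ⊙ inv v₀) (inv ((v₀ ⊙ v₁) ⊙ inv v₀) ⊙ ((v₀ ⊙ v₂) ⊙ inv v₀)) refl) (go l w)

  Gen-inv : ∀ {P} → InvClosed P → InvClosed (Gen P)
  Gen-inv {P} iP (l , w) = go l w
    where
    go : ∀ l {x} → (P ^^ l) x → Gen P (x ⁻¹)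
    go zero    refl             = 0 , solve {k = 0} (lookup []) (inv ε) ε refl
    go (suc l) {x} (s , Ps , w) = subst (Gen P)
      (solve (lookup (s ∷ x ∷ [])) (inv (inv v₀ ⊙ v₁) ⊙ inv v₀) (inv v₁) refl)
      (Gen-∙ (go l w) (Gen-incl (iP Ps)))

  module _ {P R : Fin N → Set} (cR : ConjClosed R) (iR : InvClosed R)
           (comm : ∀ {a b} → P a → P b → R (commutator G a b)) where

    -- For `a = s t` one has `[s t , b] = t⁻¹ [s , b] t [t , b]`, and closure under conjugation
    -- absorbs the `t`.
    commutator-Genˡ : ∀ b → (∀ {s} → P s → Gen R (commutator G s b)) → ∀ {a} → Gen P a → Gen R (commutator G a b)
    commutator-Genˡ b base (l , w) = go l w
      where
      go : ∀ l {a} → (P ^^ l) a → Gen R (commutator G a b)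
      go zero    refl             = 0 , solve (lookup (b ∷ [])) ((inv ε ⊙ inv v₀) ⊙ (ε ⊙ v₀)) ε refl
      go (suc l) {a} (s , Ps , w) = subst (Gen R)
        (solve (lookup (s ∷ a ∷ b ∷ []))
          (((inv t ⊙ ((inv v₀ ⊙ inv v₂) ⊙ (v₀ ⊙ v₂))) ⊙ inv (inv t)) ⊙ ((inv t ⊙ inv v₂) ⊙ (t ⊙ v₂)))
          ((inv v₁ ⊙ inv v₂) ⊙ (v₁ ⊙ v₂)) refl)
        (Gen-∙ (Gen-conj cR (((s ⁻¹) ∙ a) ⁻¹) (base Ps)) (go l w))
        where
        t : Word 3
        t = inv v₀ ⊙ v₁

    commutator-Gen : ∀ {a b} → Gen P a → Gen P b → Gen R (commutator G a b)
    commutator-Gen {a} {b} ga gb = commutator-Genˡ b (λ {s} Ps → subst (Gen R)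
      (solve (lookup (b ∷ s ∷ [])) (inv ((inv v₀ ⊙ inv v₁) ⊙ (v₀ ⊙ v₁))) ((inv v₁ ⊙ inv v₀) ⊙ (v₁ ⊙ v₀)) refl)
      (Gen-inv iR (commutator-Genˡ s (λ Pt → Gen-incl (comm Pt Ps)) gb))) ga

    -- Only the inclusion of `H` in the generated subgroup is carried along: `P` and `R` will be
    -- norm conditions on all of `G`, for one power of `F` and for its square.
    perfect-Gen : ∀ {H} → IsPerfect G H → (∀ {x} → x ∈ H → Gen P x) → ∀ {x} → x ∈ H → Gen R x
    perfect-Gen {H} perfect H⊆ {x} x∈H with ps , all∈ , refl ← proj₁ (perfect x) x∈H = go ps all∈
      where
      go : ∀ ps → All (λ p → (proj₁ p ∈ H) × (proj₂ p ∈ H)) ps → Gen R (prodComm G ps)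
      go []             []               = Gen-e
      go ((a , b) ∷ ps) ((a∈ , b∈) ∷ as) = Gen-∙ (commutator-Gen (H⊆ a∈) (H⊆ b∈)) (go ps as)

  module _ {S : Fin N → Set} (S? : Decidable S) (Se : S e) (cS : ConjClosed S) (iS : InvClosed S) where

    generated : Subset N
    generated = fromDec (^^-dec S? N)

    generated⇒Gen : ∀ {x} → x ∈ generated → Gen S x
    generated⇒Gen x∈ = N , ∈-fromDec⁻ (^^-dec S? N) x∈

    Gen⇒generated : ∀ {x} → Gen S x → x ∈ generated
    Gen⇒generated g = ∈-fromDec⁺ (^^-dec S? N) (short-words S? Se g)

    generated-normal : IsNormalSubgroup G generated
    generated-normal =
        Gen⇒generated Gen-e
      , (λ a b a∈ b∈ → Gen⇒generated (Gen-∙ (generated⇒Gen a∈) (generated⇒Gen b∈)))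
      , (λ a a∈ → Gen⇒generated (Gen-inv iS (generated⇒Gen a∈)))
      , (λ g a a∈ → Gen⇒generated (Gen-conj cS g (generated⇒Gen a∈)))

  -- Each letter costs a factor `4`. This is crude, but with `l = N` the factor is the same for
  -- every power of `F`, and such a constant disappears in `A₀≤`.
  word-bound : (f : Fin N → ℕ) → f e ≡ 0 → (∀ a b → f (a ∙ b) ≤ 2 * f a + 2 * f b) →
               ∀ t l {x} → ((λ s → f s ≤ t) ^^ l) x → f x ≤ 4 ^ l * t
  word-bound f fe f∙ t zero    refl         = ≤-trans (≤-reflexive fe) z≤n
  word-bound f fe f∙ t (suc l) {x} (s , fs≤t , w) = begin
    f x                                        ≡⟨ cong f (sym (\\-leftDividesˡ s x)) ⟩
    f (s ∙ ((s ⁻¹) ∙ x))                       ≤⟨ f∙ s ((s ⁻¹) ∙ x) ⟩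
    2 * f s + 2 * f ((s ⁻¹) ∙ x)               ≤⟨ +-mono-≤ (*-monoʳ-≤ 2 fs≤) (*-monoʳ-≤ 2 (word-bound f fe f∙ t l w)) ⟩
    2 * (4 ^ l * t) + 2 * (4 ^ l * t)          ≡⟨ collect (4 ^ l) t ⟩
    4 ^ suc l * t                              ∎
    where
    open ≤-Reasoning
    fs≤ : f s ≤ 4 ^ l * t
    fs≤ = ≤-trans fs≤t (m≤n*m t (4 ^ l) {{m^n≢0 4 l}})
    collect : ∀ p t → 2 * (p * t) + 2 * (p * t) ≡ 4 * p * t
    collect = solve-∀

-- Translates of a set

card-sum : (s : Subset n) → ∣ s ∣ ≡ sum (λ x → bit (lookup s x))
card-sum []          = refl
card-sum (true ∷ s)  = cong suc (card-sum s)
card-sum (false ∷ s) = card-sum s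

bit-mono : ∀ {a b} → (a ≡ true → b ≡ true) → bit a ≤ bit b
bit-mono {false}         h = z≤n
bit-mono {true}  {true}  h = ≤-refl
bit-mono {true}  {false} h = contradiction (h refl) λ ()

-- The term `a` stays unweighted, so that it sums over all positions to a full norm.
weigh : ∀ b a c d → (b ≡ true → c ≤ a + d) → c * bit b ≤ a + d * bit b
weigh true  a c d h = subst₂ _≤_ (sym (*-identityʳ c)) (cong (λ t → a + t) (sym (*-identityʳ d))) (h refl)
weigh false a c d h = ≤-trans (≤-reflexive (*-zeroʳ c)) z≤n

ind : Bool → ℤ
ind true  = pos 1
ind false = pos 0

sq-ind-≤1 : ∀ a → sq (ind a) ≤ 1
sq-ind-≤1 true  = ≤-refl
sq-ind-≤1 false = z≤n

sq-ind-differ : ∀ a b → sq (ind a ℤ.- ind b) ≡ differ a b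
sq-ind-differ true  true  = refl
sq-ind-differ true  false = refl
sq-ind-differ false true  = refl
sq-ind-differ false false = refl

ind-polarise : ∀ a b → pos 2 ℤ.* (ind a ℤ.* ind b) ≡ (ind a ℤ.+ ind b) ℤ.- pos (differ a b)
ind-polarise true  true  = refl
ind-polarise true  false = refl
ind-polarise false true  = refl
ind-polarise false false = refl

2*m*n≤m²+n² : ∀ x y → 2 * (x * y) ≤ x * x + y * y
2*m*n≤m²+n² x y = +-cancelˡ-≤ (2 * (x * y)) _ _ (begin
  2 * (x * y) + 2 * (x * y)          ≡⟨ double (x * y) ⟩
  4 * (x * y)                        ≤⟨ am-gm x y ⟩
  (x + y) * (x + y)                  ≡⟨ expand x y ⟩
  2 * (x * y) + (x * x + y * y)      ∎)
  where
  open ≤-Reasoning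
  double : ∀ w → 2 * w + 2 * w ≡ 4 * w
  double = solve-∀
  expand : ∀ x y → (x + y) * (x + y) ≡ 2 * (x * y) + (x * x + y * y)
  expand = solve-∀

module Covering (G : FinGroup) where
  open FinGroup G renaming (n to N)
  open Translation G hiding (D)

  -- Each nonempty class of `φ`, translated back by one of its members, is contained in `S`.
  order≤classes*card : ∀ {K} (φ : Fin N → Fin K) {S : Fin N → Set} (S? : Decidable S) →
                       (∀ g g′ → φ g ≡ φ g′ → S ((g ⁻¹) ∙ g′)) → N ≤ K * ∣ fromDec S? ∣
  order≤classes*card {K} φ {S} S? close = begin
    N                                                   ≡⟨ sym (trans (sum-const N 1) (*-identityʳ N)) ⟩
    sum {N} (λ _ → 1)                                   ≤⟨ sum-mono (λ g → ≤-trans (own g) (term≤sum (hit g) (φ g))) ⟩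
    (sum λ g → sum λ c → hit g c)                       ≡⟨ ∑-comm hit ⟩
    (sum λ c → sum λ g → hit g c)                       ≤⟨ sum-mono class ⟩
    sum {K} (λ _ → ∣ fromDec S? ∣)                      ≡⟨ sum-const K _ ⟩
    K * ∣ fromDec S? ∣                                  ∎
    where
    open ≤-Reasoning
    hit : Fin N → Fin K → ℕ
    hit g c = bit (does (φ g Fin.≟ c))
    own : ∀ g → 1 ≤ hit g (φ g)
    own g = ≤-reflexive (cong bit (sym (dec-true (φ g Fin.≟ φ g) refl)))
    does⇒ : ∀ g c → does (φ g Fin.≟ c) ≡ true → φ g ≡ c
    does⇒ g c eq with yes p ← φ g Fin.≟ c = p
    class : ∀ c → sum (λ g → hit g c) ≤ ∣ fromDec S? ∣
    class c with Fin.any? (λ g → φ g Fin.≟ c)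
    ... | no none = ≤-trans (sum-mono {g = λ _ → 0} λ g →
      ≤-reflexive (cong bit (dec-false (φ g Fin.≟ c) λ eq → none (g , eq))))
      (≤-trans (≤-reflexive (trans (sum-const N 0) (*-zeroʳ N))) z≤n)
    ... | yes (g₀ , refl) = begin
      sum (λ g → hit g (φ g₀))                  ≡⟨ sum-translate g₀ (λ g → hit g (φ g₀)) ⟩
      sum (λ x → hit (g₀ ∙ x) (φ g₀))           ≤⟨ sum-mono (λ x → bit-mono λ eq →
        Vec.[]=⇒lookup (∈-fromDec⁺ S? (subst S (\\-leftDividesʳ g₀ x) (close g₀ (g₀ ∙ x) (sym (does⇒ _ _ eq)))))) ⟩
      sum (λ x → bit (lookup (fromDec S?) x))   ≡⟨ sym (card-sum (fromDec S?)) ⟩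
      ∣ fromDec S? ∣                            ∎

module Translates (G : FinGroup) (A : Subset (FinGroup.n G)) where
  open FinGroup G renaming (n to N)
  open Translation G
  open Covering G
  open Generation G

  M : Mat N
  M g y = ind (lookup (coset G g A) y)

  dist : Fin N → Fin N → ℕ
  dist g g′ = hamming (coset G g A) (coset G g′ A)

  lookup-coset : ∀ g (B : Subset N) y → lookup (coset G g B) y ≡ lookup B ((g ⁻¹) ∙ y)
  lookup-coset g B y = Vec.lookup∘tabulate (λ y → lookup B ((g ⁻¹) ∙ y)) y

  coset-translate : ∀ k g y → lookup (coset G (k ∙ g) A) (k ∙ y) ≡ lookup (coset G g A) y
  coset-translate k g y = trans (lookup-coset (k ∙ g) A (k ∙ y)) (trans
    (cong (lookup A) (solve (lookup (k ∷ g ∷ y ∷ [])) (inv (v₀ ⊙ v₁) ⊙ (v₀ ⊙ v₂)) (inv v₁ ⊙ v₂) refl))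
    (sym (lookup-coset g A y)))

  M-invariant : Invariant M
  M-invariant k g y = cong ind (coset-translate k g y)

  open SpectralGap G M M-invariant

  dist-translate : ∀ k g g′ → dist (k ∙ g) (k ∙ g′) ≡ dist g g′
  dist-translate k g g′ = trans (sum-translate k _)
    (sum-cong-≗ λ y → cong₂ differ (coset-translate k g y) (coset-translate k g′ y))

  dist-triangle : ∀ g g′ g″ → dist g g″ ≤ dist g g′ + dist g′ g″
  dist-triangle g g′ g″ = ≤-trans
    (sum-mono λ y → differ-triangle (lookup (coset G g A) y) (lookup (coset G g′ A) y) (lookup (coset G g″ A) y))
    (≤-reflexive (∑-distrib-+ (λ y → differ (lookup (coset G g A) y) (lookup (coset G g′ A) y)) _))

  dist-sym : ∀ g g′ → dist g g′ ≡ dist g′ g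
  dist-sym g g′ = sum-cong-≗ λ y → differ-sym (lookup (coset G g A) y) (lookup (coset G g′ A) y)

  dist-refl : ∀ g → dist g g ≡ 0
  dist-refl g = trans (sum-cong-≗ {N} {y = λ _ → 0} λ y → differ-≡ {lookup (coset G g A) y} refl) (trans (sum-const N 0) (*-zeroʳ N))

  displacement : Fin N → ℕ
  displacement h = sum λ g → dist (h ∙ g) g

  norm-D-M : ∀ h → norm (D h M) ≡ displacement h
  norm-D-M h = sum-cong-≗ λ g → sum-cong-≗ λ y → sq-ind-differ (lookup (coset G (h ∙ g) A) y) (lookup (coset G g A) y)

  norm-D-F-≤ : ∀ h → norm (D h F) ≤ displacement h * (N * N)
  norm-D-F-≤ h = begin
    norm (D h F)                     ≡⟨ norm-cong (D-· h M (M ᵀ)) ⟩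
    norm (D h M · M ᵀ)               ≤⟨ norm-· (D h M) (M ᵀ) ⟩
    norm (D h M) * norm (M ᵀ)        ≤⟨ *-mono-≤ (≤-reflexive (norm-D-M h)) (sum-mono λ y → sum-mono λ g → sq-ind-≤1 (lookup (coset G g A) y)) ⟩
    displacement h * (sum {N} λ _ → sum {N} λ _ → 1)
      ≡⟨ cong (displacement h *_) (trans (sum-const N _) (cong (N *_) (trans (sum-const N 1) (*-identityʳ N)))) ⟩
    displacement h * (N * N)         ∎
    where open ≤-Reasoning

  size : ℤ
  size = ℤΣ.sum λ y → ind (lookup A y)

  sum-M : ∀ g → ℤΣ.sum (M g) ≡ size
  sum-M g = trans (sumℤ-translate g (M g)) (ℤΣ.sum-cong-≗ λ y → cong ind (trans (lookup-coset g A (g ∙ y)) (cong (lookup A) (\\-leftDividesʳ g y))))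

  -- `F g x` is the size of the intersection of two translates, and all translates have the same
  -- `size`; so differences of `F` are differences of distances.
  F-dist : ∀ g x → pos 2 ℤ.* F g x ≡ (size ℤ.+ size) ℤ.- pos (dist g x)
  F-dist g x = begin
    pos 2 ℤ.* F g x
      ≡⟨ ℤΣ.*-distribˡ-sum (pos 2) (λ y → M g y ℤ.* M x y) ⟩
    ℤΣ.sum (λ y → pos 2 ℤ.* (M g y ℤ.* M x y))
      ≡⟨ ℤΣ.sum-cong-≗ (λ y → ind-polarise (lookup (coset G g A) y) (lookup (coset G x A) y)) ⟩
    ℤΣ.sum (λ y → (M g y ℤ.+ M x y) ℤ.- pos (differ (lookup (coset G g A) y) (lookup (coset G x A) y)))
      ≡⟨ sumℤ-minus (λ y → M g y ℤ.+ M x y) _ ⟩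
    ℤΣ.sum (λ y → M g y ℤ.+ M x y) ℤ.- ℤΣ.sum (λ y → pos (differ (lookup (coset G g A) y) (lookup (coset G x A) y)))
      ≡⟨ cong₂ ℤ._-_ (trans (ℤΣ.∑-distrib-+ (M g) (M x)) (cong₂ ℤ._+_ (sum-M g) (sum-M x))) (sym (sum-pos {N} _)) ⟩
    (size ℤ.+ size) ℤ.- pos (dist g x)
      ∎
    where open ≡-Reasoning

  dist≤dist+D : ∀ h g x → dist (h ∙ g) x ≤ dist g x + 2 * ℤ.∣ D h F g x ∣
  dist≤dist+D h g x = begin
    dist (h ∙ g) x                                           ≡⟨ cong ℤ.∣_∣ expand ⟩
    ℤ.∣ pos (dist g x) ℤ.- pos 2 ℤ.* D h F g x ∣             ≤⟨ ℤ.∣i-j∣≤∣i∣+∣j∣ (pos (dist g x)) (pos 2 ℤ.* D h F g x) ⟩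
    dist g x + ℤ.∣ pos 2 ℤ.* D h F g x ∣                     ≡⟨ cong (λ t → dist g x + t) (ℤ.∣i*j∣≡∣i∣*∣j∣ (pos 2) (D h F g x)) ⟩
    dist g x + 2 * ℤ.∣ D h F g x ∣                           ∎
    where
    open ≤-Reasoning
    rearrange : ∀ s t u f f′ → pos 2 ℤ.* f ≡ s ℤ.- t → pos 2 ℤ.* f′ ≡ s ℤ.- u → t ≡ u ℤ.- pos 2 ℤ.* (f ℤ.- f′)
    rearrange s t u f f′ p q = trans (id₁ s t u) (trans (cong₂ (λ a b → u ℤ.- (a ℤ.- b)) (sym p) (sym q)) (cong (λ z → u ℤ.- z) (id₂ f f′)))
      where
      id₁ : ∀ s t u → t ≡ u ℤ.- ((s ℤ.- t) ℤ.- (s ℤ.- u))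
      id₁ = ℤ-solve-∀
      id₂ : ∀ f f′ → pos 2 ℤ.* f ℤ.- pos 2 ℤ.* f′ ≡ pos 2 ℤ.* (f ℤ.- f′)
      id₂ = ℤ-solve-∀
    expand : pos (dist (h ∙ g) x) ≡ pos (dist g x) ℤ.- pos 2 ℤ.* D h F g x
    expand = rearrange (size ℤ.+ size) _ _ _ _ (F-dist (h ∙ g) x) (F-dist g x)

  -- Displacement bounded by the differences of the Gram matrix

  module _ (q : ℕ) where

    Near : Fin N → Set
    Near x = q * dist e x ≤ N

    near? : Decidable Near
    near? x = q * dist e x ≤? N

    -- The path from `h ∙ g` to `g` through `g ∙ x` has two errors of at most `N / q` besides the
    -- change of `F`. They contribute `4 * (N * N)` after multiplication by `2 * N`, and AM-GM on
    -- the remaining product adds one more `N * N`.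
    near-term : ∀ h g x → Near x →
                2 * (N * (q * dist (h ∙ g) g)) ≤ 4 * (q * q) * sq (D h F g (g ∙ x)) + 5 * (N * N)
    near-term h g x nx = begin
      2 * (N * (q * dist (h ∙ g) g))                     ≤⟨ *-monoʳ-≤ 2 (*-monoʳ-≤ N bound) ⟩
      2 * (N * (2 * N + y))                              ≡⟨ split N y ⟩
      2 * (N * y) + 4 * (N * N)                          ≤⟨ +-monoˡ-≤ (4 * (N * N)) (2*m*n≤m²+n² N y) ⟩
      N * N + y * y + 4 * (N * N)                        ≡⟨ collect N q ℤ.∣ D h F g (g ∙ x) ∣ ⟩
      4 * (q * q) * sq (D h F g (g ∙ x)) + 5 * (N * N)   ∎
      where
      open ≤-Reasoning
      y = q * (2 * ℤ.∣ D h F g (g ∙ x) ∣)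
      split : ∀ N y → 2 * (N * (2 * N + y)) ≡ 2 * (N * y) + 4 * (N * N)
      split = solve-∀
      collect : ∀ N q w → N * N + (q * (2 * w)) * (q * (2 * w)) + 4 * (N * N) ≡ 4 * (q * q) * (w * w) + 5 * (N * N)
      collect = solve-∀
      u = dist g (g ∙ x)
      qu≤N : q * u ≤ N
      qu≤N = subst (λ t → q * t ≤ N) (trans (sym (dist-translate g e x)) (cong (λ t → dist t (g ∙ x)) (Group.identityʳ group g))) nx
      regroup : ∀ q u w → q * (u + w + u) ≡ q * u + q * u + q * w
      regroup = solve-∀
      regroup′ : ∀ N y → N + N + y ≡ 2 * N + y
      regroup′ = solve-∀
      bound : q * dist (h ∙ g) g ≤ 2 * N + y
      bound = begin
        q * dist (h ∙ g) g                                    ≤⟨ *-monoʳ-≤ q (dist-triangle (h ∙ g) (g ∙ x) g) ⟩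
        q * (dist (h ∙ g) (g ∙ x) + dist (g ∙ x) g)           ≤⟨ *-monoʳ-≤ q (+-mono-≤ (dist≤dist+D h g (g ∙ x)) (≤-reflexive (dist-sym (g ∙ x) g))) ⟩
        q * (u + 2 * ℤ.∣ D h F g (g ∙ x) ∣ + u)               ≡⟨ regroup q u _ ⟩
        q * u + q * u + y                                     ≤⟨ +-monoˡ-≤ y (+-mono-≤ qu≤N qu≤N) ⟩
        N + N + y                                             ≡⟨ regroup′ N y ⟩
        2 * N + y                                             ∎

    ν : ℕ
    ν = ∣ fromDec near? ∣

    near-sum : ∀ h → 2 * (N * (q * displacement h)) * ν ≤ 4 * (q * q) * norm (D h F) + 5 * (N * N) * (N * ν)
    near-sum h = begin
      2 * (N * (q * displacement h)) * ν
        ≡⟨ cong (_* ν) (trans (cong (λ t → 2 * (N * t)) (*-distribˡ-sum q ds)) (trans (cong (2 *_) (*-distribˡ-sum N (λ g → q * ds g))) (*-distribˡ-sum 2 (λ g → N * (q * ds g))))) ⟩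
      sum (λ g → 2 * (N * (q * ds g))) * ν
        ≡⟨ *-distribʳ-sum ν (λ g → 2 * (N * (q * ds g))) ⟩
      sum (λ g → 2 * (N * (q * ds g)) * ν)
        ≤⟨ sum-mono row ⟩
      sum (λ g → 4 * (q * q) * rowNorm g + 5 * (N * N) * ν)
        ≡⟨ ∑-distrib-+ (λ g → 4 * (q * q) * rowNorm g) (λ _ → 5 * (N * N) * ν) ⟩
      sum (λ g → 4 * (q * q) * rowNorm g) + sum {N} (λ _ → 5 * (N * N) * ν)
        ≡⟨ cong₂ _+_ (sym (*-distribˡ-sum (4 * (q * q)) rowNorm)) (trans (sum-const N _) (swap N (5 * (N * N)) ν)) ⟩
      4 * (q * q) * norm (D h F) + 5 * (N * N) * (N * ν)
        ∎
      where
      open ≤-Reasoning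
      swap : ∀ a b c → a * (b * c) ≡ b * (a * c)
      swap = solve-∀
      ds : Fin N → ℕ
      ds g = dist (h ∙ g) g
      rowNorm : Fin N → ℕ
      rowNorm g = sum λ x → sq (D h F g x)
      i : Fin N → ℕ
      i x = bit (lookup (fromDec near?) x)
      cell : ∀ g x → 2 * (N * (q * ds g)) * i x ≤ 4 * (q * q) * sq (D h F g (g ∙ x)) + 5 * (N * N) * i x
      cell g x = weigh (lookup (fromDec near?) x) (4 * (q * q) * sq (D h F g (g ∙ x))) (2 * (N * (q * ds g))) (5 * (N * N)) λ eq →
        near-term h g x (∈-fromDec⁻ near? (Vec.lookup⇒[]= x (fromDec near?) eq))
      row : ∀ g → 2 * (N * (q * ds g)) * ν ≤ 4 * (q * q) * rowNorm g + 5 * (N * N) * ν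
      row g = begin
        c * ν                                            ≡⟨ cong (c *_) (card-sum (fromDec near?)) ⟩
        c * sum i                                        ≡⟨ *-distribˡ-sum c i ⟩
        sum (λ x → c * i x)                              ≤⟨ sum-mono (cell g) ⟩
        sum (λ x → 4 * (q * q) * r x + 5 * (N * N) * i x)
          ≡⟨ ∑-distrib-+ (λ x → 4 * (q * q) * r x) (λ x → 5 * (N * N) * i x) ⟩
        sum (λ x → 4 * (q * q) * r x) + sum (λ x → 5 * (N * N) * i x)
          ≡⟨ cong₂ _+_ (sym (*-distribˡ-sum (4 * (q * q)) r)) (sym (*-distribˡ-sum (5 * (N * N)) i)) ⟩
        4 * (q * q) * sum r + 5 * (N * N) * sum i
          ≡⟨ cong₂ (λ s t → 4 * (q * q) * s + 5 * (N * N) * t) (sym (sum-translate g (λ x → sq (D h F g x)))) (sym (card-sum (fromDec near?))) ⟩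
        4 * (q * q) * rowNorm g + 5 * (N * N) * ν        ∎
        where
        c = 2 * (N * (q * ds g))
        r : Fin N → ℕ
        r x = sq (D h F g (g ∙ x))

-- The subgroup generated by elements of small displacement

module SmallDisplacement (G : FinGroup) (A : Subset (FinGroup.n G)) (ρ : ℕ) where
  open FinGroup G renaming (n to N)
  open Translation G
  open Covering G
  open Generation G
  open Translates G A
  open SpectralGap G M M-invariant

  Small : Fin N → Set
  Small h = ∀ y → dist (h ∙ y) y ≤ ρ

  small? : Decidable Small
  small? h = Fin.all? λ y → dist (h ∙ y) y ≤? ρ

  small-e : Small e
  small-e y = ≤-trans (≤-reflexive (trans (cong (λ t → dist t y) (Group.identityˡ group y)) (dist-refl y))) z≤n

  small-conj : ConjClosed Small
  small-conj g {h} sh y = subst (_≤ ρ)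
    (trans (sym (dist-translate g (h ∙ ((g ⁻¹) ∙ y)) ((g ⁻¹) ∙ y)))
      (cong₂ dist (solve (lookup (g ∷ h ∷ y ∷ [])) (v₀ ⊙ (v₁ ⊙ (inv v₀ ⊙ v₂))) (((v₀ ⊙ v₁) ⊙ inv v₀) ⊙ v₂) refl) (\\-leftDividesˡ g y)))
    (sh ((g ⁻¹) ∙ y))

  small-inv : InvClosed Small
  small-inv {h} sh y = subst (_≤ ρ)
    (trans (dist-sym (h ∙ ((h ⁻¹) ∙ y)) ((h ⁻¹) ∙ y)) (cong (dist ((h ⁻¹) ∙ y)) (\\-leftDividesˡ h y)))
    (sh ((h ⁻¹) ∙ y))

  H : Subset N
  H = generated small? small-e small-conj small-inv

  H-normal : IsNormalSubgroup G H
  H-normal = generated-normal small? small-e small-conj small-inv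

  Small⇒H : ∀ {h} → Small h → h ∈ H
  Small⇒H sh = Gen⇒generated small? small-e small-conj small-inv (Gen-incl sh)

  -- Bounds `norm (D h F)` for small `h`: each of `N` translates moves by at most `ρ`, and `N * N`
  -- is the trivial bound for the norm of `M`.
  s : ℕ
  s = N * ρ * (N * N)

  -- The recursion is that of `norm-D-commutator`. Four times the threshold is squared at each step,
  -- which gives the ratio `r = 4 * s` of the spectral gap.
  threshold : ℕ → ℕ
  threshold zero    = s
  threshold (suc k) = 4 * (threshold k * threshold k)

  threshold≤ : ∀ k → 4 * threshold k ≤ (4 * s) ^ (2 ^ k)
  threshold≤ zero    = ≤-reflexive (sym (*-identityʳ (4 * s)))
  threshold≤ (suc k) = begin
    4 * (4 * (threshold k * threshold k))          ≡⟨ square (threshold k) ⟩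
    (4 * threshold k) * (4 * threshold k)          ≤⟨ *-mono-≤ (threshold≤ k) (threshold≤ k) ⟩
    (4 * s) ^ (2 ^ k) * (4 * s) ^ (2 ^ k)          ≡⟨ sym (^-distribˡ-+-* (4 * s) (2 ^ k) (2 ^ k)) ⟩
    (4 * s) ^ (2 ^ k + 2 ^ k)                      ≡⟨ cong (λ t → (4 * s) ^ (2 ^ k + t)) (sym (+-identityʳ (2 ^ k))) ⟩
    (4 * s) ^ (2 ^ suc k)                          ∎
    where
    open ≤-Reasoning
    square : ∀ t → 4 * (4 * (t * t)) ≡ (4 * t) * (4 * t)
    square = solve-∀

  Short : ℕ → Fin N → Set
  Short k x = norm (D x (Q k)) ≤ threshold k

  -- A perfect group is generated by commutators of its generators, which are quadratically shorter.
  H⊆Gen-Short : IsPerfect G H → ∀ k {x} → x ∈ H → Gen (Short k) x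
  H⊆Gen-Short perfect zero x∈H =
    Gen-map (λ {h} sh → ≤-trans (norm-D-F-≤ h) (*-monoˡ-≤ (N * N) (≤-trans (sum-mono sh) (≤-reflexive (sum-const N ρ)))))
      (generated⇒Gen small? small-e small-conj small-inv x∈H)
  H⊆Gen-Short perfect (suc k) = perfect-Gen {P = Short k} {R = Short (suc k)}
    (λ g {x} sx → ≤-trans (≤-reflexive (norm-D-conj (Q-invariant (suc k)) g x)) sx)
    (λ {x} sx → ≤-trans (≤-reflexive (norm-D-⁻¹ x (Q (suc k)))) sx)
    (λ {a} {b} sa sb → ≤-trans (norm-D-commutator (Q-invariant k) a b) (*-monoʳ-≤ 4 (*-mono-≤ sa sb)))
    perfect (H⊆Gen-Short perfect k)

  H-short : IsPerfect G H → ∀ {h} → h ∈ H → ∀ k → norm (D h (Q k)) ≤ 4 ^ N * (4 * s) ^ (2 ^ k)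
  H-short perfect {h} h∈H k = begin
    norm (D h (Q k))                     ≤⟨ word-bound (λ x → norm (D x (Q k))) (norm-D-e (Q k)) (λ a b → norm-D-∙ a b (Q k)) (threshold k) N
                                              (short-words (λ x → norm (D x (Q k)) ≤? threshold k)
                                                (≤-trans (≤-reflexive (norm-D-e (Q k))) z≤n) (H⊆Gen-Short perfect k h∈H)) ⟩
    4 ^ N * threshold k                  ≤⟨ *-monoʳ-≤ (4 ^ N) (≤-trans (m≤n*m (threshold k) 4) (threshold≤ k)) ⟩
    4 ^ N * (4 * s) ^ (2 ^ k)            ∎
    where open ≤-Reasoning

  module _ (q k p : ℕ) .{{_ : ℕ.NonZero q}} .{{_ : ℕ.NonZero p}} (8kq≤p : 8 * (k * q) ≤ p) (ppρ≤N : p * p * ρ ≤ N)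
           (N≤kν : N ≤ k * ν q) where

    -- The ratio `4 * s` is at most `4 N⁴ / p²`, so the spectral gap has, after a square root, the
    -- factor `2 N² / p`.
    p*norm≤ : IsPerfect G H → ∀ {h} → h ∈ H → p * norm (D h F) ≤ 2 * (N * N) * displacement h
    p*norm≤ perfect {h} h∈H = square-cancel-≤ (begin
      (p * b₂) * (p * b₂)                                    ≡⟨ [m*n]*[o*p]≡[m*o]*[n*p] p b₂ p b₂ ⟩
      p * p * (b₂ * b₂)                                      ≤⟨ *-monoʳ-≤ (p * p) (norm-gap h (4 ^ N) (4 * s) (H-short perfect h∈H)) ⟩
      p * p * (4 * s * (norm (D h M) * norm (D h M)))        ≡⟨ cong (λ t → p * p * (4 * s * (t * t))) (norm-D-M h) ⟩
      p * p * (4 * s * (b₁ * b₁))                            ≡⟨ regroup p N ρ b₁ ⟩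
      (p * p * ρ) * (4 * (N * (N * N)) * (b₁ * b₁))          ≤⟨ *-monoˡ-≤ (4 * (N * (N * N)) * (b₁ * b₁)) ppρ≤N ⟩
      N * (4 * (N * (N * N)) * (b₁ * b₁))                    ≡⟨ regroup′ N b₁ ⟩
      (2 * (N * N) * b₁) * (2 * (N * N) * b₁)                ∎)
      where
      open ≤-Reasoning
      b₁ = displacement h
      b₂ = norm (D h F)
      regroup : ∀ p N ρ b → p * p * (4 * (N * ρ * (N * N)) * (b * b)) ≡ (p * p * ρ) * (4 * (N * (N * N)) * (b * b))
      regroup = solve-∀
      regroup′ : ∀ N b → N * (4 * (N * (N * N)) * (b * b)) ≡ (2 * (N * N) * b) * (2 * (N * N) * b)
      regroup′ = solve-∀

    -- Multiplied by `p`, the spectral term of `near-sum` is at most half of the left side, because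
    -- `N ≤ k * ν q` and `8 * (k * q) ≤ p`. It is absorbed, and the error term remains.
    H-displacement : IsPerfect G H → ∀ {h} → h ∈ H → q * displacement h ≤ 5 * (N * N)
    H-displacement perfect {h} h∈H = *-cancelˡ-≤ (p * N * v) {{pNv≢0}} (+-cancelˡ-≤ (p * N * v * (q * b₁)) _ _ (begin
      p * N * v * (q * b₁) + p * N * v * (q * b₁)           ≡⟨ id₁ p N v q b₁ ⟩
      p * (2 * (N * (q * b₁)) * v)                          ≤⟨ *-monoʳ-≤ p (near-sum q h) ⟩
      p * (4 * (q * q) * b₂ + 5 * (N * N) * (N * v))        ≡⟨ id₂ p q b₂ N v ⟩
      4 * (q * q) * (p * b₂) + p * N * v * (5 * (N * N))    ≤⟨ +-monoˡ-≤ (p * N * v * (5 * (N * N))) (*-monoʳ-≤ (4 * (q * q)) (p*norm≤ perfect h∈H)) ⟩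
      4 * (q * q) * (2 * (N * N) * b₁) + p * N * v * (5 * (N * N))
        ≡⟨ cong (_+ p * N * v * (5 * (N * N))) (id₃ q N b₁) ⟩
      8 * (q * q) * N * b₁ * N + p * N * v * (5 * (N * N))    ≤⟨ +-monoˡ-≤ (p * N * v * (5 * (N * N))) (*-monoʳ-≤ (8 * (q * q) * N * b₁) N≤kν) ⟩
      8 * (q * q) * N * b₁ * (k * v) + p * N * v * (5 * (N * N))
        ≡⟨ cong (_+ p * N * v * (5 * (N * N))) (id₄ q N b₁ k v) ⟩
      8 * (k * q) * (N * v * (q * b₁)) + p * N * v * (5 * (N * N))
        ≤⟨ +-monoˡ-≤ (p * N * v * (5 * (N * N))) (*-monoˡ-≤ (N * v * (q * b₁)) 8kq≤p) ⟩
      p * (N * v * (q * b₁)) + p * N * v * (5 * (N * N))      ≡⟨ cong (_+ p * N * v * (5 * (N * N))) (id₅ p N v (q * b₁)) ⟩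
      p * N * v * (q * b₁) + p * N * v * (5 * (N * N))        ∎))
      where
      open ≤-Reasoning
      v = ν q
      b₁ = displacement h
      b₂ = norm (D h F)
      id₁ : ∀ p N v q b → p * N * v * (q * b) + p * N * v * (q * b) ≡ p * (2 * (N * (q * b)) * v)
      id₁ = solve-∀
      id₂ : ∀ p q b N v → p * (4 * (q * q) * b + 5 * (N * N) * (N * v)) ≡ 4 * (q * q) * (p * b) + p * N * v * (5 * (N * N))
      id₂ = solve-∀
      id₃ : ∀ q N b → 4 * (q * q) * (2 * (N * N) * b) ≡ 8 * (q * q) * N * b * N
      id₃ = solve-∀
      id₄ : ∀ q N b k v → 8 * (q * q) * N * b * (k * v) ≡ 8 * (k * q) * (N * v * (q * b))
      id₄ = solve-∀
      id₅ : ∀ p N v w → p * (N * v * w) ≡ p * N * v * w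
      id₅ = solve-∀
      positive : ∀ {N} → Fin N → N ≢ 0
      positive {suc _} _ ()
      v≢0 : v ≢ 0
      v≢0 v≡0 = positive e (n≤0⇒n≡0 (≤-trans N≤kν (≤-reflexive (trans (cong (k *_) v≡0) (*-zeroʳ k)))))
      pNv≢0 : ℕ.NonZero (p * N * v)
      pNv≢0 = m*n≢0 (p * N) v {{m*n≢0 p N {{it}} {{ℕ.≢-nonZero (positive e)}}}} {{ℕ.≢-nonZero v≢0}}

halve : ∀ q a b {N d} → 2 * q * a ≤ N → 2 * q * b ≤ N → d ≤ a + b → q * d ≤ N
halve q a b {N} {d} ha hb hd = *-cancelˡ-≤ 2 (begin
  2 * (q * d)                ≡⟨ sym (*-assoc 2 q d) ⟩
  2 * q * d                  ≤⟨ *-monoʳ-≤ (2 * q) hd ⟩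
  2 * q * (a + b)            ≡⟨ *-distribˡ-+ (2 * q) a b ⟩
  2 * q * a + 2 * q * b      ≤⟨ +-mono-≤ ha hb ⟩
  N + N                      ≡⟨ cong (λ t → N + t) (sym (+-identityʳ N)) ⟩
  2 * N                      ∎)
  where open ≤-Reasoning

-- Counting classes of translates

module Index (G : FinGroup) (A : Subset (FinGroup.n G)) where
  open FinGroup G renaming (n to N)
  open Translation G
  open Covering G
  open Translates G A

  dist-quotient : ∀ g g′ → dist e ((g ⁻¹) ∙ g′) ≡ dist g g′
  dist-quotient g g′ = trans (sym (dist-translate g e ((g ⁻¹) ∙ g′)))
    (cong₂ dist (Group.identityʳ group g) (\\-leftDividesˡ g g′))

  order≤k*ν : ∀ q k (x : Fin k → Fin N) → (∀ g → ∃ λ i → suc (suc (2 * q)) * dist g (x i) ≤ N) → N ≤ k * ν q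
  order≤k*ν q k x cover = order≤classes*card (λ g → proj₁ (cover g)) (near? q) close
    where
    close : ∀ g g′ → proj₁ (cover g) ≡ proj₁ (cover g′) → Near q ((g ⁻¹) ∙ g′)
    close g g′ same with cover g | cover g′ | same
    ... | i , cg | .i , cg′ | refl = subst (λ t → q * t ≤ N) (sym (dist-quotient g g′))
      (halve q (dist g (x i)) (dist (x i) g′) (weaken (dist g (x i)) cg) (weaken (dist (x i) g′) (≤-trans (≤-reflexive (cong (suc (suc (2 * q)) *_) (dist-sym (x i) g′))) cg′))
        (dist-triangle g (x i) g′))
      where
      -- `covering-number` provides scales of the form `p + 2`; the surplus `2` is given away.
      weaken : ∀ d → suc (suc (2 * q)) * d ≤ N → 2 * q * d ≤ N
      weaken d = ≤-trans (*-monoˡ-≤ d (m≤n+m (2 * q) 2))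

  module _ (ρ P k : ℕ) (x : Fin k → Fin N) (cover : ∀ g → ∃ λ i → suc (suc (2 * (2 * P))) * dist g (x i) ≤ N)
           (P*d≤N⇒d≤ρ : ∀ d → P * d ≤ N → d ≤ ρ) where
    open SmallDisplacement G A ρ

    private
      index : Fin N → Fin k
      index g = proj₁ (cover g)

      cover′ : ∀ g → 2 * (2 * P) * dist g (x (index g)) ≤ N
      cover′ g = ≤-trans (*-monoˡ-≤ _ (m≤n+m (2 * (2 * P)) 2)) (proj₂ (cover g))

    -- h = g⁻¹g′ moves every y little as soon as g·xᵢ and g′·xᵢ lie in the same class for all centres xᵢ.
    order≤index*card : N ≤ k ^ k * ∣ H ∣
    order≤index*card = ≤-trans (order≤classes*card classes small? close)
      (*-monoʳ-≤ (k ^ k) (Subset.p⊆q⇒∣p∣≤∣q∣ λ h∈ → Small⇒H (∈-fromDec⁻ small? h∈)))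
      where
      classes : Fin N → Fin (k ^ k)
      classes g = funToFin λ i → index (g ∙ x i)
      same-class : ∀ g g′ → classes g ≡ classes g′ → ∀ i → index (g ∙ x i) ≡ index (g′ ∙ x i)
      same-class g g′ eq i = trans (sym (Fin.finToFun-funToFin (λ i → index (g ∙ x i)) i))
        (trans (cong (λ c → finToFun c i) eq) (Fin.finToFun-funToFin (λ i → index (g′ ∙ x i)) i))
      -- Replacing `y` by its centre reduces all `y` to finitely many points `g ∙ x i`. Every
      -- triangle inequality halves the scale, and after this second halving one is left for
      -- `close`.
      halfway : ∀ g y → 2 * P * dist (g ∙ y) (x (index (g ∙ x (index y)))) ≤ N
      halfway g y = halve (2 * P) (dist (g ∙ y) (g ∙ x (index y))) (dist (g ∙ x (index y)) (x (index (g ∙ x (index y)))))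
        (subst (λ t → 2 * (2 * P) * t ≤ N) (sym (dist-translate g y (x (index y)))) (cover′ y))
        (cover′ (g ∙ x (index y)))
        (dist-triangle (g ∙ y) (g ∙ x (index y)) (x (index (g ∙ x (index y)))))
      close : ∀ g g′ → classes g ≡ classes g′ → Small ((g ⁻¹) ∙ g′)
      close g g′ eq y = subst (_≤ ρ)
        (trans (dist-sym (g ∙ y) (g′ ∙ y)) (trans (cong (λ t → dist t (g ∙ y))
          (solve (lookup (g ∷ g′ ∷ y ∷ [])) (v₁ ⊙ v₂) (v₀ ⊙ ((inv v₀ ⊙ v₁) ⊙ v₂)) refl))
          (dist-translate g (((g ⁻¹) ∙ g′) ∙ y) y)))
        (P*d≤N⇒d≤ρ _ (halve P (dist (g ∙ y) (x j)) (dist (x j) (g′ ∙ y)) (halfway g y)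
          (subst (λ t → 2 * P * t ≤ N) (dist-sym (g′ ∙ y) (x j))
            (subst (λ i → 2 * P * dist (g′ ∙ y) (x i) ≤ N) (sym (same-class g g′ eq (index y))) (halfway g′ y)))
          (dist-triangle (g ∙ y) (x j) (g′ ∙ y))))
        where
        j = index (g ∙ x (index y))

-- Choice of the scales

Covers : ℕ → ℕ → ℕ → Set
Covers d p k = ∀ {n N} (S : Fin N → Subset n) → Fin N → FamilyVC≤ S (suc d) →
               ∃ λ (x : Fin k → Fin N) → ∀ g → ∃ λ i → suc (suc p) * hamming (S g) (S (x i)) ≤ n

-- The order of choices matters: `q` is the wanted precision, `k` the covering number at that scale,
-- `p` exceeds `8 * (k * q)`, and `l` is the covering number at the scale of `p * p`. Rounding in
-- `ρ` loses nothing, since `d ≤ ρ` means exactly `p * p * d ≤ N`.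
almost-invariance-index : ∀ d q k l .{{_ : ℕ.NonZero q}} → Covers d (2 * q) k →
  Covers d (2 * (2 * (suc (8 * (k * q)) * suc (8 * (k * q))))) l →
  (G : FinGroup) → PurelyNonabelian G → (A : Subset (FinGroup.n G)) → VCdim≤ G A (suc d) →
  ∃ λ H → IsNormalSubgroup G H × order G ≤ l ^ l * ∣ H ∣ ×
          (∀ {h} → h ∈ H → q * Translates.displacement G A h ≤ 5 * (order G * order G))
almost-invariance-index d q k l coarse fine G (_ , perfect) A vc =
    H , H-normal
  , Index.order≤index*card G A ρ (p * p) l (proj₁ fineCover) (proj₂ fineCover)
      (λ d le → ≤-trans (≤-reflexive (sym (m*n/n≡m d (p * p))))
                        (/-monoˡ-≤ (p * p) (≤-trans (≤-reflexive (*-comm d (p * p))) le)))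
  , H-displacement q k p (n≤1+n _) (≤-trans (≤-reflexive (*-comm (p * p) ρ)) (m/n*n≤m N (p * p)))
      (Index.order≤k*ν G A q k (proj₁ coarseCover) (proj₂ coarseCover)) (perfect H H-normal)
  where
  open FinGroup G renaming (n to N)
  p = suc (8 * (k * q))
  ρ = N / (p * p)
  open SmallDisplacement G A ρ
  coarseCover = coarse (λ g → coset G g A) e vc
  fineCover = fine (λ g → coset G g A) e vc

almost-invariance : ∀ d q .{{_ : ℕ.NonZero q}} → ∃ λ K → (G : FinGroup) → PurelyNonabelian G →
  (A : Subset (FinGroup.n G)) → VCdim≤ G A (suc d) →
  ∃ λ H → IsNormalSubgroup G H × order G ≤ K * ∣ H ∣ ×
          (∀ {h} → h ∈ H → q * Translates.displacement G A h ≤ 5 * (order G * order G))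
almost-invariance d q =
  let k , coarse = covering-number d (2 * q)
      l , fine = covering-number d (2 * (2 * (suc (8 * (k * q)) * suc (8 * (k * q)))))
  in l ^ l , almost-invariance-index d q k l coarse fine

-- From almost invariance to cosets

∣p∩q∣+∣p─q∣ : (p q : Subset n) → ∣ p ∩ q ∣ + ∣ p ─ q ∣ ≡ ∣ p ∣
∣p∩q∣+∣p─q∣ []          []          = refl
∣p∩q∣+∣p─q∣ (true ∷ p)  (true ∷ q)  = cong suc (∣p∩q∣+∣p─q∣ p q)
∣p∩q∣+∣p─q∣ (true ∷ p)  (false ∷ q) = trans (+-suc _ _) (cong suc (∣p∩q∣+∣p─q∣ p q))
∣p∩q∣+∣p─q∣ (false ∷ p) (true ∷ q)  = ∣p∩q∣+∣p─q∣ p q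
∣p∩q∣+∣p─q∣ (false ∷ p) (false ∷ q) = ∣p∩q∣+∣p─q∣ p q

∣p∩q∣-sum : (p q : Subset n) → ∣ p ∩ q ∣ ≡ sum (λ u → bit (lookup p u) * differ false (lookup q u))
∣p∩q∣-sum []          []          = refl
∣p∩q∣-sum (true ∷ p)  (true ∷ q)  = cong suc (∣p∩q∣-sum p q)
∣p∩q∣-sum (true ∷ p)  (false ∷ q) = ∣p∩q∣-sum p q
∣p∩q∣-sum (false ∷ p) (true ∷ q)  = ∣p∩q∣-sum p q
∣p∩q∣-sum (false ∷ p) (false ∷ q) = ∣p∩q∣-sum p q

∣p─q∣-sum : (p q : Subset n) → ∣ p ─ q ∣ ≡ sum (λ u → bit (lookup p u) * differ true (lookup q u))
∣p─q∣-sum []          []          = refl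
∣p─q∣-sum (true ∷ p)  (true ∷ q)  = ∣p─q∣-sum p q
∣p─q∣-sum (true ∷ p)  (false ∷ q) = cong suc (∣p─q∣-sum p q)
∣p─q∣-sum (false ∷ p) (true ∷ q)  = ∣p─q∣-sum p q
∣p─q∣-sum (false ∷ p) (false ∷ q) = ∣p─q∣-sum p q

x∈p─q⇒x∉q : ∀ (p q : Subset n) {x} → x ∈ p ─ q → x ∉ q
x∈p─q⇒x∉q (_ ∷ p) (false ∷ q) Data.Vec.here         ()
x∈p─q⇒x∉q (_ ∷ p) (true ∷ q)  (Data.Vec.there x∈)   (Data.Vec.there x∈q) = x∈p─q⇒x∉q p q x∈ x∈q
x∈p─q⇒x∉q (_ ∷ p) (false ∷ q) (Data.Vec.there x∈)   (Data.Vec.there x∈q) = x∈p─q⇒x∉q p q x∈ x∈q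

markov : ∀ (s : Subset n) (a c : ℕ) (w : Fin n → ℕ) → (∀ z → z ∈ s → a ≤ c * w z) → ∣ s ∣ * a ≤ c * sum w
markov s a c w h = begin
  ∣ s ∣ * a                              ≡⟨ cong (_* a) (card-sum s) ⟩
  sum (λ z → bit (lookup s z)) * a       ≡⟨ *-distribʳ-sum a (λ z → bit (lookup s z)) ⟩
  sum (λ z → bit (lookup s z) * a)       ≤⟨ sum-mono cell ⟩
  sum (λ z → c * w z)                    ≡⟨ sym (*-distribˡ-sum c w) ⟩
  c * sum w                              ∎
  where
  open ≤-Reasoning
  cell : ∀ z → bit (lookup s z) * a ≤ c * w z
  cell z with lookup s z in eq
  ... | true  = ≤-trans (≤-reflexive (+-identityʳ a)) (h z (Vec.lookup⇒[]= z s eq))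
  ... | false = z≤n

module Averaging (G : FinGroup) (A H : Subset (FinGroup.n G)) (normal : IsNormalSubgroup G H) where
  open FinGroup G renaming (n to N)
  open Translation G
  open Translates G A

  e∈H     = proj₁ normal
  ∙∈H     = proj₁ (proj₂ normal)
  ⁻¹∈H    = proj₁ (proj₂ (proj₂ normal))
  conj∈H  = proj₂ (proj₂ (proj₂ normal))

  N≢0 : N ≢ 0
  N≢0 = nonempty e
    where
    nonempty : ∀ {N} → Fin N → N ≢ 0
    nonempty {suc _} _ ()

  inside outside : Fin N → ℕ
  inside  z = ∣ coset G z H ∩ A ∣
  outside z = ∣ coset G z H ─ A ∣

  minority : Fin N → ℕ
  minority z = sum λ u → bit (lookup (coset G z H) u) * differ (lookup A z) (lookup A u)

  inside+outside : ∀ z → inside z + outside z ≡ ∣ H ∣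
  inside+outside z = begin
    inside z + outside z                            ≡⟨ ∣p∩q∣+∣p─q∣ (coset G z H) A ⟩
    ∣ coset G z H ∣                                 ≡⟨ card-sum (coset G z H) ⟩
    sum (λ u → bit (lookup (coset G z H) u))        ≡⟨ sum-translate z (λ u → bit (lookup (coset G z H) u)) ⟩
    sum (λ u → bit (lookup (coset G z H) (z ∙ u)))
      ≡⟨ sum-cong-≗ (λ u → cong bit (trans (lookup-coset z H (z ∙ u)) (cong (lookup H) (\\-leftDividesʳ z u)))) ⟩
    sum (λ u → bit (lookup H u))                    ≡⟨ sym (card-sum H) ⟩
    ∣ H ∣                                           ∎
    where open ≡-Reasoning

  minority-∈ : ∀ {z} → lookup A z ≡ true → minority z ≡ outside z
  minority-∈ {z} eq rewrite eq = sym (∣p─q∣-sum (coset G z H) A)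

  minority-∉ : ∀ {z} → lookup A z ≡ false → minority z ≡ inside z
  minority-∉ {z} eq rewrite eq = sym (∣p∩q∣-sum (coset G z H) A)

  -- Substitute y = gz and u = g⁻¹h⁻¹gz in the displacements; by normality, u ∈ zH forces h ∈ H.
  minority-displacement : N * sum minority ≤ sum (λ h → bit (lookup H h) * displacement h)
  minority-displacement = begin
    N * sum minority                                       ≡⟨ sym (sum-const N (sum minority)) ⟩
    sum {N} (λ _ → sum minority)                           ≤⟨ sum-mono (λ g → sum-mono λ z → transport g z) ⟩
    (sum λ g → sum λ z → sum λ h → term h g z)             ≡⟨ sum-cong-≗ (λ g → ∑-comm (λ z h → term h g z)) ⟩
    (sum λ g → sum λ h → sum λ z → term h g z)             ≡⟨ ∑-comm (λ g h → sum λ z → term h g z) ⟩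
    (sum λ h → sum λ g → sum λ z → term h g z)             ≡⟨ sum-cong-≗ collect ⟩
    sum (λ h → bit (lookup H h) * displacement h)          ∎
    where
    open ≤-Reasoning
    term : Fin N → Fin N → Fin N → ℕ
    term h g z = bit (lookup H h) * differ (lookup A z) (lookup A ((g ⁻¹) ∙ ((h ⁻¹) ∙ (g ∙ z))))
    conj-quotient : ∀ g z u → lookup (coset G z H) u ≡ true → lookup H ((g ∙ z) ∙ ((u ⁻¹) ∙ (g ⁻¹))) ≡ true
    conj-quotient g z u eq = Vec.[]=⇒lookup (subst (_∈ H)
      (solve (lookup (g ∷ z ∷ u ∷ [])) (((v₀ ⊙ v₁) ⊙ inv (inv v₁ ⊙ v₂)) ⊙ inv (v₀ ⊙ v₁)) ((v₀ ⊙ v₁) ⊙ (inv v₂ ⊙ inv v₀)) refl)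
      (conj∈H (g ∙ z) _ (⁻¹∈H _ (Vec.lookup⇒[]= _ H (trans (sym (lookup-coset z H u)) eq)))))
    transport : ∀ g z → minority z ≤ sum (λ h → term h g z)
    transport g z = begin
      minority z
        ≤⟨ sum-mono (λ u → *-mono-≤ (bit-mono (conj-quotient g z u)) (≤-reflexive (cong (differ (lookup A z) ∘ lookup A)
             (solve (lookup (g ∷ z ∷ u ∷ [])) v₂ (inv v₀ ⊙ (inv ((v₀ ⊙ v₁) ⊙ (inv v₂ ⊙ inv v₀)) ⊙ (v₀ ⊙ v₁))) refl)))) ⟩
      sum (λ u → term ((g ∙ z) ∙ ((u ⁻¹) ∙ (g ⁻¹))) g z)
        ≡⟨ sym (sum-reindex (λ h → term h g z) (λ u → (g ∙ z) ∙ ((u ⁻¹) ∙ (g ⁻¹))) (λ h → (g ⁻¹) ∙ ((h ⁻¹) ∙ (g ∙ z)))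
             (λ h → solve (lookup (g ∷ z ∷ h ∷ [])) ((v₀ ⊙ v₁) ⊙ (inv (inv v₀ ⊙ (inv v₂ ⊙ (v₀ ⊙ v₁))) ⊙ inv v₀)) v₂ refl)
             (λ u → solve (lookup (g ∷ z ∷ u ∷ [])) (inv v₀ ⊙ (inv ((v₀ ⊙ v₁) ⊙ (inv v₂ ⊙ inv v₀)) ⊙ (v₀ ⊙ v₁))) v₂ refl)) ⟩
      sum (λ h → term h g z)
        ∎
    pointwise : ∀ h g z → differ (lookup (coset G (h ∙ g) A) (g ∙ z)) (lookup (coset G g A) (g ∙ z))
                ≡ differ (lookup A z) (lookup A ((g ⁻¹) ∙ ((h ⁻¹) ∙ (g ∙ z))))
    pointwise h g z = trans (differ-sym (lookup (coset G (h ∙ g) A) (g ∙ z)) _) (cong₂ differ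
      (trans (lookup-coset g A (g ∙ z)) (cong (lookup A) (\\-leftDividesʳ g z)))
      (trans (lookup-coset (h ∙ g) A (g ∙ z)) (cong (lookup A)
        (solve (lookup (h ∷ g ∷ z ∷ [])) (inv (v₀ ⊙ v₁) ⊙ (v₁ ⊙ v₂)) (inv v₁ ⊙ (inv v₀ ⊙ (v₁ ⊙ v₂))) refl))))
    collect : ∀ h → (sum λ g → sum λ z → term h g z) ≡ bit (lookup H h) * displacement h
    collect h = sym (≡.trans (*-distribˡ-sum b (λ g → dist (h ∙ g) g)) (sum-cong-≗ λ g →
      ≡.trans (cong (b *_) (≡.trans
          (sum-translate g (λ y → differ (lookup (coset G (h ∙ g) A) y) (lookup (coset G g A) y)))
          (sum-cong-≗ (pointwise h g))))
        (*-distribˡ-sum b (λ z → differ (lookup A z) (lookup A ((g ⁻¹) ∙ ((h ⁻¹) ∙ (g ∙ z))))))))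
      where
      b = bit (lookup H h)

  module _ (c : ℕ) .{{_ : ℕ.NonZero c}}
           (almost : ∀ {h} → h ∈ H → 20 * (c * c * (c * c)) * displacement h ≤ 5 * (N * N)) where

    private
      c⁴ = c * c * (c * c)

    H≢0 : ∣ H ∣ ≢ 0
    H≢0 eq = contradiction (≤-trans (≤-reflexive (sym (Subset.∣⁅x⁆∣≡1 e)))
      (Subset.p⊆q⇒∣p∣≤∣q∣ λ x∈ → subst (_∈ H) (sym (Subset.x∈⁅y⁆⇒x≡y e x∈)) e∈H)) (<⇒≱ (subst (_< 1) (sym eq) (s≤s z≤n)))

    -- The `20` is four times the `5` of `H-displacement`, so a factor `4` is left. The structure
    -- statement needs a `2` of it for Markov; the regularity statement needs a `2` for the factor
    -- one half and a `2` for strictness.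
    minority-small : 4 * c⁴ * sum minority ≤ N * ∣ H ∣
    minority-small = *-cancelˡ-≤ (5 * N) {{m*n≢0 5 N {{_}} {{ℕ.≢-nonZero N≢0}}}} (begin
      5 * N * (4 * c⁴ * sum minority)                        ≡⟨ id₁ N c⁴ (sum minority) ⟩
      20 * c⁴ * (N * sum minority)                           ≤⟨ *-monoʳ-≤ (20 * c⁴) minority-displacement ⟩
      20 * c⁴ * sum (λ h → bit (lookup H h) * displacement h)   ≡⟨ *-distribˡ-sum (20 * c⁴) (λ h → bit (lookup H h) * displacement h) ⟩
      sum (λ h → 20 * c⁴ * (bit (lookup H h) * displacement h)) ≤⟨ sum-mono cell ⟩
      sum (λ h → 5 * (N * N) * bit (lookup H h))             ≡⟨ sym (*-distribˡ-sum (5 * (N * N)) (λ h → bit (lookup H h))) ⟩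
      5 * (N * N) * sum (λ h → bit (lookup H h))             ≡⟨ cong (5 * (N * N) *_) (sym (card-sum H)) ⟩
      5 * (N * N) * ∣ H ∣                                    ≡⟨ id₂ N ∣ H ∣ ⟩
      5 * N * (N * ∣ H ∣)                                    ∎)
      where
      open ≤-Reasoning
      id₁ : ∀ N c s → 5 * N * (4 * c * s) ≡ 20 * c * (N * s)
      id₁ = solve-∀
      id₂ : ∀ N h → 5 * (N * N) * h ≡ 5 * N * (N * h)
      id₂ = solve-∀
      cell : ∀ h → 20 * c⁴ * (bit (lookup H h) * displacement h) ≤ 5 * (N * N) * bit (lookup H h)
      cell h with lookup H h in eq
      ... | false = ≤-trans (≤-reflexive (*-zeroʳ (20 * c⁴))) z≤n
      ... | true  = subst₂ _≤_ (cong (20 * c⁴ *_) (sym (*-identityˡ (displacement h)))) (sym (*-identityʳ (5 * (N * N))))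
                      (almost (Vec.lookup⇒[]= h H eq))

    coset-≡ : ∀ {x y} → y ∈ coset G x H → coset G y H ≡ coset G x H
    coset-≡ {x} {y} y∈ = Vec.tabulate-cong λ u → Bool.⇔→≡ {z = true}
      (mk⇔ (λ eq → Vec.[]=⇒lookup (subst (_∈ H)
          (solve (lookup (x ∷ y ∷ u ∷ [])) ((inv v₀ ⊙ v₁) ⊙ (inv v₁ ⊙ v₂)) (inv v₀ ⊙ v₂) refl)
          (∙∈H _ _ x⁻¹y∈ (Vec.lookup⇒[]= _ H eq))))
        (λ eq → Vec.[]=⇒lookup (subst (_∈ H)
          (solve (lookup (x ∷ y ∷ u ∷ [])) (inv (inv v₀ ⊙ v₁) ⊙ (inv v₀ ⊙ v₂)) (inv v₁ ⊙ v₂) refl)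
          (∙∈H _ _ (⁻¹∈H _ x⁻¹y∈) (Vec.lookup⇒[]= _ H eq)))))
      where
      x⁻¹y∈ : ((x ⁻¹) ∙ y) ∈ H
      x⁻¹y∈ = Vec.lookup⇒[]= _ H (trans (sym (lookup-coset x H y)) (Vec.[]=⇒lookup y∈))

    majority? : Decidable (λ z → ∣ H ∣ ≤ 2 * inside z)
    majority? z = ∣ H ∣ ≤? 2 * inside z

    Dset : Subset N
    Dset = fromDec majority?

    D-union : UnionOfCosets G H Dset
    D-union x x∈ y∈ = ∈-fromDec⁺ majority?
      (subst (λ B → ∣ H ∣ ≤ 2 * ∣ B ∩ A ∣) (sym (coset-≡ y∈)) (∈-fromDec⁻ majority? x∈))

    -- A point of the difference lies on the smaller side of its coset, so at least half of the
    -- coset disagrees with it.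
    A△D-minority : ∀ z → z ∈ A △ Dset → ∣ H ∣ ≤ 2 * minority z
    A△D-minority z z∈ with Subset.x∈p∪q⁻ (A ─ Dset) (Dset ─ A) z∈
    ... | inj₁ z∈A─D = begin
      ∣ H ∣                        ≡⟨ sym (inside+outside z) ⟩
      inside z + outside z         ≤⟨ +-monoˡ-≤ (outside z) (<⇒≤ minor) ⟩
      outside z + outside z        ≡⟨ cong (λ t → outside z + t) (sym (+-identityʳ (outside z))) ⟩
      2 * outside z                ≡⟨ cong (2 *_) (sym (minority-∈ (Vec.[]=⇒lookup (Subset.p─q⊆p A Dset z∈A─D)))) ⟩
      2 * minority z               ∎
      where
      open ≤-Reasoning
      minor : inside z < outside z
      minor = +-cancelˡ-< (inside z) (inside z) (outside z) (begin-strict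
        inside z + inside z        ≡⟨ cong (λ t → inside z + t) (sym (+-identityʳ (inside z))) ⟩
        2 * inside z               <⟨ ≰⇒> (λ le → x∈p─q⇒x∉q A Dset z∈A─D (∈-fromDec⁺ majority? le)) ⟩
        ∣ H ∣                      ≡⟨ sym (inside+outside z) ⟩
        inside z + outside z       ∎)
    ... | inj₂ z∈D─A = ≤-trans (∈-fromDec⁻ majority? (Subset.p─q⊆p Dset A z∈D─A))
      (≤-reflexive (cong (2 *_) (sym (minority-∉ (Bool.¬-not (λ eq → x∈p─q⇒x∉q Dset A z∈D─A (Vec.lookup⇒[]= z A eq)))))))

    A△D-small : c⁴ * ∣ A △ Dset ∣ ≤ N
    A△D-small = *-cancelʳ-≤ _ _ (2 * ∣ H ∣) {{m*n≢0 2 ∣ H ∣ {{_}} {{ℕ.≢-nonZero H≢0}}}} (begin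
      c⁴ * ∣ A △ Dset ∣ * (2 * ∣ H ∣)       ≡⟨ id₁ c⁴ ∣ A △ Dset ∣ ∣ H ∣ ⟩
      2 * c⁴ * (∣ A △ Dset ∣ * ∣ H ∣)       ≤⟨ *-monoʳ-≤ (2 * c⁴) (markov (A △ Dset) ∣ H ∣ 2 minority A△D-minority) ⟩
      2 * c⁴ * (2 * sum minority)           ≡⟨ id₂ c⁴ (sum minority) ⟩
      4 * c⁴ * sum minority                 ≤⟨ minority-small ⟩
      N * ∣ H ∣                             ≤⟨ *-monoʳ-≤ N (m≤n*m ∣ H ∣ 2) ⟩
      N * (2 * ∣ H ∣)                       ∎)
      where
      open ≤-Reasoning
      id₁ : ∀ c a h → c * a * (2 * h) ≡ 2 * c * (a * h)
      id₁ = solve-∀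
      id₂ : ∀ c w → 2 * c * (2 * w) ≡ 4 * c * w
      id₂ = solve-∀

    irregular? : Decidable (λ z → ∣ H ∣ < c * inside z × ∣ H ∣ < c * outside z)
    irregular? z = (∣ H ∣ <? c * inside z) ×-dec (∣ H ∣ <? c * outside z)

    Z : Subset N
    Z = fromDec irregular?

    -- On an irregular coset both sides are large, hence also the side opposite to `z`.
    Z-minority : ∀ z → z ∈ Z → ∣ H ∣ ≤ c * minority z
    Z-minority z z∈ = cases (lookup A z) refl
      where
      irregular = ∈-fromDec⁻ irregular? z∈
      cases : ∀ b → lookup A z ≡ b → ∣ H ∣ ≤ c * minority z
      cases true  eq = ≤-trans (<⇒≤ (proj₂ irregular)) (≤-reflexive (cong (c *_) (sym (minority-∈ eq))))
      cases false eq = ≤-trans (<⇒≤ (proj₁ irregular)) (≤-reflexive (cong (c *_) (sym (minority-∉ eq))))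

    -- Of the four factors `c` in `c⁴`, Markov uses one, two enter the bound and one is dropped. A
    -- spare factor `2` together with `N ≢ 0` makes the inequality strict.
    Z-small : 2 * (c * c) * ∣ Z ∣ < N
    Z-small = halve-< _ N≢0 (*-cancelʳ-≤ _ _ ∣ H ∣ {{ℕ.≢-nonZero H≢0}} (begin
      2 * (2 * (c * c) * ∣ Z ∣) * ∣ H ∣     ≤⟨ m≤m*n _ c ⟩
      2 * (2 * (c * c) * ∣ Z ∣) * ∣ H ∣ * c ≡⟨ id₁ c ∣ Z ∣ ∣ H ∣ ⟩
      4 * (c * c * c) * (∣ Z ∣ * ∣ H ∣)     ≤⟨ *-monoʳ-≤ (4 * (c * c * c)) (markov Z ∣ H ∣ c minority Z-minority) ⟩
      4 * (c * c * c) * (c * sum minority)  ≡⟨ id₂ c (sum minority) ⟩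
      4 * c⁴ * sum minority                 ≤⟨ minority-small ⟩
      N * ∣ H ∣                             ∎))
      where
      open ≤-Reasoning
      id₁ : ∀ c z h → 2 * (2 * (c * c) * z) * h * c ≡ 4 * (c * c * c) * (z * h)
      id₁ = solve-∀
      id₂ : ∀ c w → 4 * (c * c * c) * (c * w) ≡ 4 * (c * c * (c * c)) * w
      id₂ = solve-∀
      halve-< : ∀ a {b} → b ≢ 0 → 2 * a ≤ b → a < b
      halve-< zero    b≢0 _  = n≢0⇒n>0 b≢0
      halve-< (suc a) _   le = ≤-trans (s≤s (m<m+n a (s≤s z≤n))) le

    regular : ∀ x → x ∉ Z → c * inside x ≤ ∣ H ∣ ⊎ c * outside x ≤ ∣ H ∣
    regular x x∉Z with c * inside x ≤? ∣ H ∣ | c * outside x ≤? ∣ H ∣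
    ... | yes le | _      = inj₁ le
    ... | _      | yes le = inj₂ le
    ... | no ¬i  | no ¬o  = contradiction (∈-fromDec⁺ irregular? (≰⇒> ¬i , ≰⇒> ¬o)) x∉Z

-- Rational bounds

toℚᵘ-ℕ→ℚ : ∀ k → ℚ.toℚᵘ (ℕ→ℚ k) ℚᵘ.≃ mkℚᵘ (pos k) 0
toℚᵘ-ℕ→ℚ k = ℚ.toℚᵘ-fromℚᵘ (mkℚᵘ (pos k) 0)

ℕ→ℚ-mono-≤ : m ≤ n → ℕ→ℚ m ≤ℚ ℕ→ℚ n
ℕ→ℚ-mono-≤ {m} {n} m≤n = ℚ.toℚᵘ-cancel-≤
  (ℚᵘ.≤-respˡ-≃ (ℚᵘ.≃-sym (toℚᵘ-ℕ→ℚ m)) (ℚᵘ.≤-respʳ-≃ (ℚᵘ.≃-sym (toℚᵘ-ℕ→ℚ n))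
    (ℚᵘ.*≤* (ℤ.*-monoʳ-≤-nonNeg (pos 1) (ℤ.+≤+ m≤n)))))

ℕ→ℚ-mono-< : m < n → ℕ→ℚ m <ℚ ℕ→ℚ n
ℕ→ℚ-mono-< {m} {n} m<n = ℚ.toℚᵘ-cancel-<
  (ℚᵘ.<-respˡ-≃ (ℚᵘ.≃-sym (toℚᵘ-ℕ→ℚ m)) (ℚᵘ.<-respʳ-≃ (ℚᵘ.≃-sym (toℚᵘ-ℕ→ℚ n))
    (ℚᵘ.*<* (ℤ.*-monoʳ-<-pos (pos 1) (ℤ.+<+ m<n)))))

½*ℕ→ℚ-double : ∀ k → ℕ→ℚ k ≡ ½ *ℚ ℕ→ℚ (2 * k)
½*ℕ→ℚ-double k = ℚ.toℚᵘ-injective (ℚᵘ.≃-trans (toℚᵘ-ℕ→ℚ k) (ℚᵘ.≃-sym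
  (ℚᵘ.≃-trans (ℚ.toℚᵘ-homo-* ½ (ℕ→ℚ (2 * k))) (ℚᵘ.≃-trans (ℚᵘ.*-cong {ℚ.toℚᵘ ½} ℚᵘ.≃-refl (toℚᵘ-ℕ→ℚ (2 * k)))
    (ℚᵘ.*≡* (identity (pos k) (pos (2 * k)) (ℤ.pos-* 2 k)))))))
  where
  identity : ∀ x y → y ≡ pos 2 ℤ.* x → pos 1 ℤ.* y ℤ.* pos 1 ≡ x ℤ.* (pos 2 ℤ.* pos 1)
  identity x .(pos 2 ℤ.* x) refl = normal x
    where
    normal : ∀ x → pos 1 ℤ.* (pos 2 ℤ.* x) ℤ.* pos 1 ≡ x ℤ.* (pos 2 ℤ.* pos 1)
    normal = ℤ-solve-∀

-- The numerator of a positive rational is at least `1`, so the rational is at least the reciprocal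
-- of its denominator.
scaleᵘ : ∀ p .{{_ : ℚᵘ.Positive p}} k → mkℚᵘ (pos k) 0 ℚᵘ.≤ p ℚᵘ.* mkℚᵘ (pos (ℚᵘ.denominatorℕ p * k)) 0
scaleᵘ (mkℚᵘ (pos (suc a)) d) k = ℚᵘ.*≤* (subst₂ ℤ._≤_ (ℤ.pos-* k (suc d * 1))
  (trans (ℤ.pos-* (suc a * (suc d * k)) 1) (cong (ℤ._* pos 1) (ℤ.pos-* (suc a) (suc d * k))))
  (ℤ.+≤+ (begin
    k * (suc d * 1)                    ≡⟨ regroup k (suc d) ⟩
    suc d * k                          ≤⟨ m≤n*m (suc d * k) (suc a) ⟩
    suc a * (suc d * k)                ≡⟨ sym (*-identityʳ _) ⟩
    suc a * (suc d * k) * 1            ∎)))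
  where
  open ≤-Reasoning
  regroup : ∀ k d → k * (d * 1) ≡ d * k
  regroup = solve-∀

module _ (δ : ℚ) (δ>0 : 0ℚ <ℚ δ) where

  private instance
    δ-positive : ℚ.Positive δ
    δ-positive = ℚ.positive δ>0
    δ-nonNegative : ℚ.NonNegative δ
    δ-nonNegative = ℚ.pos⇒nonNeg δ
    δδ-nonNegative : ℚ.NonNegative (δ *ℚ δ)
    δδ-nonNegative = ℚ.pos⇒nonNeg (δ *ℚ δ) {{ℚ.pos*pos⇒pos δ δ}}

  denominator : ℕ
  denominator = ℚᵘ.denominatorℕ (ℚ.toℚᵘ δ)

  scale : ∀ k → ℕ→ℚ k ≤ℚ δ *ℚ ℕ→ℚ (denominator * k)
  scale k = ℚ.toℚᵘ-cancel-≤
    (ℚᵘ.≤-respˡ-≃ (ℚᵘ.≃-sym (toℚᵘ-ℕ→ℚ k)) (ℚᵘ.≤-respʳ-≃ (ℚᵘ.≃-sym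
      (ℚᵘ.≃-trans (ℚ.toℚᵘ-homo-* δ (ℕ→ℚ (denominator * k))) (ℚᵘ.*-cong {ℚ.toℚᵘ δ} ℚᵘ.≃-refl (toℚᵘ-ℕ→ℚ (denominator * k)))))
      (scaleᵘ (ℚ.toℚᵘ δ) k)))

  scale² : ∀ k → ℕ→ℚ k ≤ℚ (δ *ℚ δ) *ℚ ℕ→ℚ (denominator * (denominator * k))
  scale² k = ℚ.≤-trans (scale k) (ℚ.≤-trans (ℚ.*-monoˡ-≤-nonNeg δ (scale (denominator * k)))
    (ℚ.≤-reflexive (sym (ℚ.*-assoc δ δ _))))

  scale-≤ : ∀ k N → denominator * k ≤ N → ℕ→ℚ k ≤ℚ δ *ℚ ℕ→ℚ N
  scale-≤ k N le = ℚ.≤-trans (scale k) (ℚ.*-monoˡ-≤-nonNeg δ (ℕ→ℚ-mono-≤ le))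

  scale⁴-≤ : ∀ k N → denominator * denominator * (denominator * denominator) * k ≤ N →
             ℕ→ℚ k ≤ℚ ((δ *ℚ δ) *ℚ (δ *ℚ δ)) *ℚ ℕ→ℚ N
  scale⁴-≤ k N le = ℚ.≤-trans (scale² k) (ℚ.≤-trans
    (ℚ.*-monoˡ-≤-nonNeg (δ *ℚ δ) (ℚ.≤-trans (scale² (c * (c * k)))
      (ℚ.*-monoˡ-≤-nonNeg (δ *ℚ δ) (ℕ→ℚ-mono-≤ (≤-trans (≤-reflexive (regroup c k)) le)))))
    (ℚ.≤-reflexive (sym (ℚ.*-assoc (δ *ℚ δ) (δ *ℚ δ) (ℕ→ℚ N)))))
    where
    c = denominator
    regroup : ∀ c k → c * (c * (c * (c * k))) ≡ c * c * (c * c) * k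
    regroup = solve-∀

  ½*scale²-< : ∀ k N → 2 * (denominator * denominator) * k < N → ℕ→ℚ k <ℚ (½ *ℚ (δ *ℚ δ)) *ℚ ℕ→ℚ N
  ½*scale²-< k N lt = subst₂ _<ℚ_ (sym (½*ℕ→ℚ-double k)) (sym (ℚ.*-assoc ½ (δ *ℚ δ) (ℕ→ℚ N)))
    (ℚ.*-monoʳ-<-pos ½ (ℚ.≤-<-trans (scale² (2 * k))
      (ℚ.*-monoʳ-<-pos (δ *ℚ δ) {{ℚ.pos*pos⇒pos δ δ}} (ℕ→ℚ-mono-< (≤-<-trans (≤-reflexive (regroup c k)) lt)))))
    where
    c = denominator
    regroup : ∀ c k → c * (c * (2 * k)) ≡ 2 * (c * c) * k
    regroup = solve-∀

theorem8p4 : (d : ℕ) → 1 ≤ d → (δ : ℚ) → 0ℚ <ℚ δ →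
    ∃[ K ] ((G : FinGroup) → PurelyNonabelian G →
    (A : Subset (FinGroup.n G)) → VCdim≤ G A d →
    ∃[ H ] (IsNormalSubgroup G H
    × order G ≤ K * ∣ H ∣
    × ∃[ D ] (UnionOfCosets G H D
    × ℕ→ℚ ∣ A △ D ∣ ≤ℚ ((δ *ℚ δ) *ℚ (δ *ℚ δ)) *ℚ ℕ→ℚ (order G))
    × ∃[ Z ] (ℕ→ℚ ∣ Z ∣ <ℚ (½ *ℚ (δ *ℚ δ)) *ℚ ℕ→ℚ (order G)
    × (∀ x → x ∉ Z →
    (ℕ→ℚ ∣ coset G x H ∩ A ∣ ≤ℚ δ *ℚ ℕ→ℚ ∣ H ∣)
    ⊎ (ℕ→ℚ ∣ coset G x H ─ A ∣ ≤ℚ δ *ℚ ℕ→ℚ ∣ H ∣)))))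
theorem8p4 (suc d) _ δ δ>0 = K , λ G pna A vc →
  let H , normal , order≤ , almost = invariance G pna A vc
      module Av = Averaging G A H normal
  in H , normal , order≤
   , Av.Dset c almost , (Av.D-union c almost , scale⁴-≤ δ δ>0 _ (order G) (Av.A△D-small c almost))
   , Av.Z c almost , ½*scale²-< δ δ>0 _ (order G) (Av.Z-small c almost) , λ x x∉Z →
       [ (λ le → inj₁ (scale-≤ δ δ>0 _ ∣ H ∣ le)) , (λ le → inj₂ (scale-≤ δ δ>0 _ ∣ H ∣ le)) ]′
         (Av.regular c almost x x∉Z)
  where
  -- `δ` stands for the fourth root of `ε`. As `1 / c ≤ δ`, it suffices to bound by `1 / c⁴` in
  -- place of `ε`, whence the precision `20 * c⁴` below.
  c = denominator δ δ>0
  K = proj₁ (almost-invariance d (20 * (c * c * (c * c))))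
  invariance = proj₂ (almost-invariance d (20 * (c * c * (c * c))))
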